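{- Let $p$ be a prime, $m\ge1$ and $r\ge1$ integers, and $n=p^m$. For $\beta\in\mathbb{Z}_{p^m}$ let $p^t=\gcd(\beta,p^m)$ with $0\le t\le m$, and let $N_\beta$ be the number of matrices $X\in\mathrm{GL}_r(\mathbb{Z}_{p^m})$ with $\mathrm{tr}\,X=\beta$. Then $$N_\beta=\begin{cases}p^{m(r^2-1)}\left(\prod_{i=1}^r(1-p^{ -i})-(-1)^rp^{ -r(r+1)/2}\right), & t=0,\\[4pt] p^{m(r^2-1)}\left(\prod_{i=1}^r(1-p^{ -i})+(-1)^rp^{ -r(r+1)/2}(p-1)\right), & \text{otherwise}.\end{cases}$$
   Context: $\mathbb{Z}_{p^m}=\mathbb{Z}/p^m\mathbb{Z}$ and $\mathrm{GL}_r(\mathbb{Z}_{p^m})$ is the group of invertible $r\times r$ matrices over it; $\gcd(\beta,p^m)$ means the gcd of any integer representative of $\beta$ with $p^m$. -}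

module Defs where

open import Data.Nat as ℕ using (ℕ; zero; suc; NonZero; _^_)
open import Data.Nat.Properties using (m^n≢0)
open import Data.Nat.DivMod using (_mod_)
open import Data.Nat.Primality using (Prime; prime⇒nonZero)
open import Data.Fin using (Fin; toℕ)
open import Data.Fin.Base using () renaming (zero to fz; suc to fs)
open import Data.Vec using (Vec; tabulate; lookup)
open import Data.Product using (Σ; _×_; ∃)
open import Data.Integer using (+_)
open import Data.Rational as ℚ using (ℚ; 1ℚ; 0ℚ; _/_)
open import Relation.Binary.PropositionalEquality using (_≡_)
open import Function.Bundles using (_↔_)

sumFin : (r : ℕ) → (Fin r → ℕ) → ℕ
sumFin zero    f = 0
sumFin (suc r) f = f fz ℕ.+ sumFin r (λ i → f (fs i))

-- r × r matrices over ℤ/nℤ (entries represented by Fin n), as vectors of rows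
Mat : ℕ → ℕ → Set
Mat n r = Vec (Vec (Fin n) r) r

entry : ∀ {n r} → Mat n r → Fin r → Fin r → Fin n
entry X i j = lookup (lookup X i) j

_⊗_ : ∀ {n r} .{{_ : NonZero n}} → Mat n r → Mat n r → Mat n r
_⊗_ {n} {r} X Y =
  tabulate (λ i → tabulate (λ k →
    sumFin r (λ j → toℕ (entry X i j) ℕ.* toℕ (entry Y j k)) mod n))

idMat : ∀ {n r} .{{_ : NonZero n}} → Mat n r
idMat {n} {r} = tabulate (λ i → tabulate (λ j → δ i j mod n))
  where
  δ : ∀ {k} → Fin k → Fin k → ℕ
  δ fz     fz     = 1
  δ fz     (fs _) = 0
  δ (fs _) fz     = 0
  δ (fs i) (fs j) = δ i j

trace : ∀ {n r} .{{_ : NonZero n}} → Mat n r → Fin n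
trace {n} {r} X = sumFin r (λ i → toℕ (entry X i i)) mod n

IsInvertible : ∀ {n r} .{{_ : NonZero n}} → Mat n r → Set
IsInvertible {n} {r} X = Σ (Mat n r) (λ Y → (X ⊗ Y ≡ idMat) × (Y ⊗ X ≡ idMat))

GLWithTrace : (n r : ℕ) .{{_ : NonZero n}} → Fin n → Set
GLWithTrace n r β = Σ (Mat n r) (λ X → IsInvertible X × (trace X ≡ β))

HasCard : Set → ℕ → Set
HasCard A k = Fin k ↔ A

primePow≢0 : ∀ {p} → Prime p → (m : ℕ) → NonZero (p ^ m)
primePow≢0 {p} pp m = m^n≢0 p m {{prime⇒nonZero pp}}

fromℕℚ : ℕ → ℚ
fromℕℚ k = + k / 1

-- 1/k as a rational (junk value 0 for k = 0; only used with k prime)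
recipℕ : ℕ → ℚ
recipℕ zero    = 0ℚ
recipℕ (suc k) = + 1 / suc k

powℚ : ℚ → ℕ → ℚ
powℚ q zero    = 1ℚ
powℚ q (suc i) = q ℚ.* powℚ q i

prodℚ : ℕ → (ℕ → ℚ) → ℚ
prodℚ zero    f = 1ℚ
prodℚ (suc r) f = prodℚ r f ℚ.* f (suc r)

{-# OPTIONS --safe #-}

-- Let n = pᵐ and s = pᵐ⁻¹, and sort the matrices X = ((a , v) , (w , D)) of size k + 1 by their
-- first column (a , w).
--
-- If w has a unit entry, adding multiples of the first column to the other columns permutes the
-- invertible matrices with that first column and translates the trace, so these X contribute
-- equally to every trace.  If all entries of w are nonunits, then X can only be invertible if a is
-- a unit, and the Schur complement reduces the count to size k: as w·v is a nonunit and by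
-- induction the count depends only on whether the trace is a unit, these X contribute
-- nᵏ N_k(β − a) for each a and w.  With Uₖ and Vₖ the counts at unit and at nonunit traces, this
-- gives Vₖ₊₁ − Uₖ₊₁ = − sᵏ⁺¹ nᵏ (Vₖ − Uₖ).  The same elimination gives
-- |GLₖ₊₁| = (nᵏ⁺¹ − sᵏ⁺¹) nᵏ |GLₖ|, and |GLₖ| = (n − s) Uₖ + s Vₖ then determines both.
module Submission where

open import Defs
open import Data.Nat using (ℕ; _≤_; _^_; _*_; _+_; _/_; _∸_)
open import Data.Nat.GCD using (gcd)
open import Data.Nat.Primality using (Prime)
open import Data.Fin using (Fin; toℕ)
open import Data.Product using (∃-syntax; _×_)
open import Data.Rational using (ℚ; 1ℚ; -_; _-_)
import Data.Rational as Q
open import Relation.Binary.PropositionalEquality using (_≡_; _≢_)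

open import Algebra.Bundles using (CommutativeRing)
open import Algebra.Core using (Op₁; Op₂)
import Algebra.Properties.Ring
import Algebra.Properties.Semiring.Sum
import Algebra.Solver.Ring.NaturalCoefficients.Default
open import Algebra.Structures using (IsCommutativeRing)
open import Axiom.UniquenessOfIdentityProofs.WithK using () renaming (uip to ≡-irrelevant)
open import Data.Empty using (⊥-elim)
open import Data.Fin using (zero; suc)
import Data.Fin.Properties as Finₚ
import Data.Integer as ℤ
import Data.Integer.Properties as ℤₚ
open import Data.Nat as ℕ using (zero; suc; _<_; s≤s; NonZero)
open import Data.Nat.Coprimality using (Coprime; coprime-Bézout; coprime-divisor; coprime⇒gcd≡1)
open import Data.Nat.Divisibility
open import Data.Nat.DivMod
  using (_mod_; _%_; %-distribˡ-+; %-distribˡ-*; m<n⇒m%n≡m; n%n≡0; [m+kn]%n≡m%n; +-distrib-/-∣ʳ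
        ; m*n/n≡m)
open import Data.Nat.GCD using (module Bézout; gcd-greatest)
open import Data.Nat.Primality using (prime⇒nonZero; prime⇒nonTrivial; prime⇒irreducible)
import Data.Nat.Properties as ℕₚ
open import Data.Nat.Solver using (module +-*-Solver)
open import Data.Product using (Σ; ∃; _,_; proj₁; proj₂)
open import Data.Rational using (toℚᵘ)
import Data.Rational.Properties as ℚₚ
import Data.Rational.Solver
import Data.Rational.Unnormalised as ℚᵘ
import Data.Rational.Unnormalised.Properties as ℚᵘₚ
open import Data.Sum using (_⊎_; inj₁; inj₂)
open import Data.Sum.Function.Propositional using (_⊎-↔_)
open import Data.Unit using (⊤; tt)
open import Data.Vec using (Vec; []; _∷_; zipWith; lookup; replicate; map; tabulate; tail)
import Data.Vec.Properties as Vecₚ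
open import Data.Vec.Relation.Binary.Pointwise.Extensional using (ext; Pointwise-≡⇒≡)
open import Data.Vec.Relation.Unary.All using (All; []; _∷_; all?)
import Data.Vec.Relation.Unary.All.Properties as Allₚ
open import Function using (_∘_)
open import Function.Bundles using (_↔_; mk↔ₛ′; Inverse)
open import Function.Properties.Inverse using (↔-trans)
open import Level using (0ℓ)
open import Relation.Binary.PropositionalEquality
  using (refl; sym; trans; cong; cong₂; subst; subst₂; isEquivalence; module ≡-Reasoning)
open import Relation.Nullary using (Dec; yes; no; ¬_; Irrelevant)
open import Relation.Nullary.Decidable using (_×-dec_; _→-dec_; ¬?; map′)
open import Algebra.Properties.Semiring.Sum ℕₚ.+-*-semiring
  using (sum; sum-cong-≗; sum-permute; ∑-distrib-+; *-distribˡ-sum)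

-- Finite sums and cardinalities

-- The difference of the counts at a nonunit b₀ and a unit b₁ is easier to reach than either count
-- alone. Only first columns with a unit and w made of nonunits tell b₀ and b₁ apart. There b₀ - a
-- is always a unit, while b₁ - a is a nonunit for exactly s values of a, all of them units; these
-- trade Uₖ for Vₖ, and with sᵏ choices of w and nᵏ of v this is the factor sᵏ⁺¹ nᵏ.
--
-- The induction starts at size 1: the empty matrix has trace 0 only, so once m > 1 the count at
-- size 0 separates 0 from the other nonunits.
--
-- No determinants occur. Invertibility is replaced by a trivial kernel, and finiteness leads back.
-- Describing the nonunits as the annihilator of σ makes membership decidable, makes closure under
-- sums an equation, and supplies the kernel vector (σ, 0, ..., 0) when the first column has no
-- unit. Every recurrence is an equation in ℕ without subtraction; rationals enter only for the
-- closed forms.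

data Shape : Set where
  fin : ℕ → Shape
  vec : Shape → ℕ → Shape

El : Shape → Set
El (fin n)   = Fin n
El (vec S k) = Vec (El S) k

-- An iterated sum over the entries. It unfolds along `∷` by computation, so splitting off the first
-- row of a matrix costs nothing, and one recursion over shapes serves scalars, vectors and
-- matrices.
∑ : ∀ S → (El S → ℕ) → ℕ
∑ (fin n)         f = sum f
∑ (vec S zero)    f = f []
∑ (vec S (suc k)) f = ∑ S λ x → ∑ (vec S k) λ v → f (x ∷ v)

∑-cong : ∀ S {f g} → (∀ x → f x ≡ g x) → ∑ S f ≡ ∑ S g
∑-cong (fin n)         f≗g = sum-cong-≗ f≗g
∑-cong (vec S zero)    f≗g = f≗g []
∑-cong (vec S (suc k)) f≗g = ∑-cong S λ x → ∑-cong (vec S k) λ v → f≗g (x ∷ v)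

∑-+ : ∀ S f g → ∑ S (λ x → f x + g x) ≡ ∑ S f + ∑ S g
∑-+ (fin n)         f g = ∑-distrib-+ f g
∑-+ (vec S zero)    f g = refl
∑-+ (vec S (suc k)) f g =
  trans (∑-cong S λ x → ∑-+ (vec S k) (f ∘ (x ∷_)) (g ∘ (x ∷_))) (∑-+ S _ _)

∑-*ˡ : ∀ S c f → ∑ S (λ x → c * f x) ≡ c * ∑ S f
∑-*ˡ (fin n)         c f = sym (*-distribˡ-sum c f)
∑-*ˡ (vec S zero)    c f = refl
∑-*ˡ (vec S (suc k)) c f =
  trans (∑-cong S λ x → ∑-*ˡ (vec S k) c (f ∘ (x ∷_))) (∑-*ˡ S c _)

∑-*ʳ : ∀ S c f → ∑ S (λ x → f x * c) ≡ ∑ S f * c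
∑-*ʳ S c f = begin
  ∑ S (λ x → f x * c) ≡⟨ ∑-cong S (λ x → ℕₚ.*-comm (f x) c) ⟩
  ∑ S (λ x → c * f x) ≡⟨ ∑-*ˡ S c f ⟩
  c * ∑ S f           ≡⟨ ℕₚ.*-comm c _ ⟩
  ∑ S f * c           ∎
  where open ≡-Reasoning

∑-zero : ∀ S → ∑ S (λ _ → 0) ≡ 0
∑-zero S = ∑-*ˡ S 0 (λ _ → 0)

∑-swap : ∀ S T (f : El S → El T → ℕ) →
         ∑ S (λ x → ∑ T (f x)) ≡ ∑ T (λ y → ∑ S (λ x → f x y))
∑-swap (fin zero)      T f = sym (∑-zero T)
∑-swap (fin (suc n))   T f =
  trans (cong (∑ T (f zero) +_) (∑-swap (fin n) T (f ∘ suc))) (sym (∑-+ T _ _))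
∑-swap (vec S zero)    T f = refl
∑-swap (vec S (suc k)) T f =
  trans (∑-cong S λ x → ∑-swap (vec S k) T (f ∘ (x ∷_))) (∑-swap S T _)

-- Distributivity, for weights that are products over the entries. It counts all vectors and the
-- vectors of nonunits.
∑-∏ : ∀ S k (f : El S → ℕ) (g : ∀ {k} → Vec (El S) k → ℕ) →
      g [] ≡ 1 → (∀ {k} x (v : Vec (El S) k) → g (x ∷ v) ≡ f x * g v) →
      ∑ (vec S k) g ≡ ∑ S f ^ k
∑-∏ S zero    f g g[] g∷ = g[]
∑-∏ S (suc k) f g g[] g∷ = begin
  ∑ S (λ x → ∑ (vec S k) λ v → g (x ∷ v))
    ≡⟨ ∑-cong S (λ x → trans (∑-cong (vec S k) (g∷ x)) (∑-*ˡ (vec S k) (f x) g)) ⟩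
  ∑ S (λ x → f x * ∑ (vec S k) g)         ≡⟨ ∑-*ʳ S _ f ⟩
  ∑ S f * ∑ (vec S k) g                   ≡⟨ cong (∑ S f *_) (∑-∏ S k f g g[] g∷) ⟩
  ∑ S f * ∑ S f ^ k                       ∎
  where open ≡-Reasoning

∑-fin-const : ∀ n c → ∑ (fin n) (λ _ → c) ≡ n * c
∑-fin-const zero    c = refl
∑-fin-const (suc n) c = cong (c +_) (∑-fin-const n c)

∑-vec-const : ∀ n k c → ∑ (vec (fin n) k) (λ _ → c) ≡ n ^ k * c
∑-vec-const n k c = begin
  ∑ (vec (fin n) k) (λ _ → c)     ≡⟨ ∑-cong (vec (fin n) k) (λ _ → sym (ℕₚ.*-identityˡ c)) ⟩
  ∑ (vec (fin n) k) (λ _ → 1 * c) ≡⟨ ∑-*ʳ (vec (fin n) k) c _ ⟩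
  ∑ (vec (fin n) k) (λ _ → 1) * c
    ≡⟨ cong (_* c) (∑-∏ (fin n) k (λ _ → 1) (λ _ → 1) refl (λ _ _ → refl)) ⟩
  ∑ (fin n) (λ _ → 1) ^ k * c
    ≡⟨ cong (λ z → z ^ k * c) (trans (∑-fin-const n 1) (ℕₚ.*-identityʳ n)) ⟩
  n ^ k * c                       ∎
  where open ≡-Reasoning

∑-permute : ∀ {n} (π π⁻¹ : Fin n → Fin n) → (∀ x → π (π⁻¹ x) ≡ x) → (∀ x → π⁻¹ (π x) ≡ x) →
            ∀ f → ∑ (fin n) (f ∘ π) ≡ ∑ (fin n) f
∑-permute π π⁻¹ invˡ invʳ f = sym (sum-permute f (mk↔ₛ′ π π⁻¹ invˡ invʳ))

-- Splits the first column off a matrix: in each row the sum over the remaining entries is moved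
-- past the sum over the later heads.
∑-zipWith-∷ : ∀ S k l (f : Vec (Vec (El S) (suc k)) l → ℕ) →
  ∑ (vec (vec S (suc k)) l) f ≡
  ∑ (vec S l) λ w → ∑ (vec (vec S k) l) λ D → f (zipWith _∷_ w D)
∑-zipWith-∷ S k zero    f = refl
∑-zipWith-∷ S k (suc l) f = ∑-cong S λ x →
  trans (∑-cong (vec S k) λ v → ∑-zipWith-∷ S k l (f ∘ ((x ∷ v) ∷_)))
        (∑-swap (vec S k) (vec S l) _)

-- Indicators of decidable propositions

ind : ∀ {P : Set} → Dec P → ℕ
ind (yes _) = 1
ind (no  _) = 0

ind-cong : ∀ {P Q : Set} (P? : Dec P) (Q? : Dec Q) → (P → Q) → (Q → P) → ind P? ≡ ind Q?
ind-cong (yes p) (yes q) f g = refl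
ind-cong (yes p) (no ¬q) f g = ⊥-elim (¬q (f p))
ind-cong (no ¬p) (yes q) f g = ⊥-elim (¬p (g q))
ind-cong (no ¬p) (no ¬q) f g = refl

ind-× : ∀ {P Q : Set} (P? : Dec P) (Q? : Dec Q) → ind (P? ×-dec Q?) ≡ ind P? * ind Q?
ind-× (yes p) (yes q) = refl
ind-× (yes p) (no ¬q) = refl
ind-× (no ¬p) Q?      = refl

ind-yes : ∀ {P : Set} (P? : Dec P) → P → ind P? ≡ 1
ind-yes P? p = ind-cong P? (yes tt) _ (λ _ → p)

ind-no : ∀ {P : Set} (P? : Dec P) → ¬ P → ind P? ≡ 0
ind-no P? ¬p = ind-cong P? (no λ ()) ¬p (λ ())

∑-δ : ∀ n (b : Fin n) → ∑ (fin n) (λ a → ind (a Finₚ.≟ b)) ≡ 1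
∑-δ (suc n) zero    = cong suc (∑-zero (fin n))
∑-δ (suc n) (suc b) =
  trans (∑-cong (fin n) λ a → ind-cong (suc a Finₚ.≟ suc b) (a Finₚ.≟ b) Finₚ.suc-injective (cong suc))
        (∑-δ n b)

-- Exhaustive search and cardinalities over shapes

all-El? : ∀ S {P : El S → Set} → (∀ x → Dec (P x)) → Dec (∀ x → P x)
all-El? (fin n)         P? = Finₚ.all? P?
all-El? (vec S zero)    P? = map′ (λ p → λ { [] → p }) (λ p → p []) (P? [])
all-El? (vec S (suc k)) P? =
  map′ (λ p → λ { (x ∷ v) → p x v }) (λ p x v → p (x ∷ v))
       (all-El? S λ x → all-El? (vec S k) λ v → P? (x ∷ v))

HasCard-dec : ∀ {P : Set} (P? : Dec P) → Irrelevant P → HasCard P (ind P?)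
HasCard-dec (yes p) irr = mk↔ₛ′ (λ _ → p) (λ _ → zero) (irr p) (λ { zero → refl })
HasCard-dec (no ¬p) irr = mk↔ₛ′ (λ ()) (⊥-elim ∘ ¬p) (⊥-elim ∘ ¬p) (λ ())

Σ-Fin-suc : ∀ {n} {B : Fin (suc n) → Set} → (B zero ⊎ Σ (Fin n) (B ∘ suc)) ↔ Σ (Fin (suc n)) B
Σ-Fin-suc = mk↔ₛ′
  (λ { (inj₁ b) → zero , b ; (inj₂ (i , b)) → suc i , b })
  (λ { (zero , b) → inj₁ b ; (suc i , b) → inj₂ (i , b) })
  (λ { (zero , b) → refl ; (suc i , b) → refl })
  (λ { (inj₁ b) → refl ; (inj₂ (i , b)) → refl })

Σ-Vec-∷ : ∀ {A : Set} {k} {B : Vec A (suc k) → Set} →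
          Σ A (λ x → Σ (Vec A k) λ v → B (x ∷ v)) ↔ Σ (Vec A (suc k)) B
Σ-Vec-∷ {A} {k} {B} = mk↔ₛ′ to from to∘from (λ _ → refl)
  where
  to : Σ A (λ x → Σ (Vec A k) λ v → B (x ∷ v)) → Σ (Vec A (suc k)) B
  to (x , v , b) = x ∷ v , b

  from : Σ (Vec A (suc k)) B → Σ A (λ x → Σ (Vec A k) λ v → B (x ∷ v))
  from (x ∷ v , b) = x , v , b

  to∘from : ∀ y → to (from y) ≡ y
  to∘from (x ∷ v , b) = refl

Σ-Vec-[] : ∀ {A : Set} {B : Vec A 0 → Set} → B [] ↔ Σ (Vec A 0) B
Σ-Vec-[] = mk↔ₛ′ (λ b → [] , b) (λ { ([] , b) → b }) (λ { ([] , b) → refl }) (λ _ → refl)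

-- The passage from bijections to arithmetic: a dependent sum is a disjoint union of its fibres,
-- taken one entry at a time.
HasCard-∑ : ∀ S {B : El S → Set} {f : El S → ℕ} →
            (∀ x → HasCard (B x) (f x)) → HasCard (Σ (El S) B) (∑ S f)
HasCard-∑ (fin zero)      c = mk↔ₛ′ (λ ()) (λ { (() , _) }) (λ { (() , _) }) (λ ())
HasCard-∑ (fin (suc n))   c =
  ↔-trans Finₚ.+↔⊎ (↔-trans (c zero ⊎-↔ HasCard-∑ (fin n) (c ∘ suc)) Σ-Fin-suc)
HasCard-∑ (vec S zero)    c = ↔-trans (c []) Σ-Vec-[]
HasCard-∑ (vec S (suc k)) c = ↔-trans (HasCard-∑ S λ x → HasCard-∑ (vec S k) λ v → c (x ∷ v)) Σ-Vec-∷

-- Counting over a finite local ring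

-- The hypotheses on σ make the ring local with maximal ideal { x ∣ σ ⊙ x ≡ 𝟘 }; for ℤ/pᵐ take σ = pᵐ⁻¹.
module LocalRing
  {n : ℕ} (_⊕_ _⊙_ : Op₂ (Fin n)) (⊖_ : Op₁ (Fin n)) (𝟘 𝟙 : Fin n)
  (isCommutativeRing : IsCommutativeRing _≡_ _⊕_ _⊙_ ⊖_ 𝟘 𝟙)
  (σ : Fin n) (σ≢𝟘 : σ ≢ 𝟘) (unit : ∀ x → σ ⊙ x ≢ 𝟘 → ∃ λ y → x ⊙ y ≡ 𝟙)
  where

  commutativeRing : CommutativeRing 0ℓ 0ℓ
  commutativeRing = record { isCommutativeRing = isCommutativeRing }

  private
    module R where
      open CommutativeRing commutativeRing public
      open Algebra.Properties.Semiring.Sum semiring public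
      open Algebra.Properties.Ring ring public
    module RS = Algebra.Solver.Ring.NaturalCoefficients.Default R.commutativeSemiring

  open RS using (solve; _:+_; _:*_; _:=_)

  ⊕-⊕-⊖ : ∀ x y → (x ⊕ y) ⊕ (⊖ y) ≡ x
  ⊕-⊕-⊖ x y = trans (R.+-assoc x y _) (trans (cong (x ⊕_) (R.-‿inverseʳ y)) (R.+-identityʳ x))

  ⊕-⊖-⊕ : ∀ x y → (x ⊕ (⊖ y)) ⊕ y ≡ x
  ⊕-⊖-⊕ x y = trans (R.+-assoc x _ y) (trans (cong (x ⊕_) (R.-‿inverseˡ y)) (R.+-identityʳ x))

  -- Dot products and block matrices

  infixl 6 _⊕ᵥ_
  infixl 7 _⊙ᵥ_

  dot : ∀ {k} → Vec (Fin n) k → Vec (Fin n) k → Fin n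
  dot v u = R.sum λ i → lookup v i ⊙ lookup u i

  _⊕ᵥ_ : ∀ {k} → Vec (Fin n) k → Vec (Fin n) k → Vec (Fin n) k
  _⊕ᵥ_ = zipWith _⊕_

  _⊙ᵥ_ : ∀ {k} → Fin n → Vec (Fin n) k → Vec (Fin n) k
  c ⊙ᵥ v = map (c ⊙_) v

  𝟘ᵥ : ∀ {k} → Vec (Fin n) k
  𝟘ᵥ = replicate _ 𝟘

  dot-𝟘ʳ : ∀ {k} (v : Vec (Fin n) k) → dot v 𝟘ᵥ ≡ 𝟘
  dot-𝟘ʳ []      = refl
  dot-𝟘ʳ (x ∷ v) = trans (cong₂ _⊕_ (R.zeroʳ x) (dot-𝟘ʳ v)) (R.+-identityˡ 𝟘)

  dot-comm : ∀ {k} (v u : Vec (Fin n) k) → dot v u ≡ dot u v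
  dot-comm v u = R.sum-cong-≗ λ i → R.*-comm (lookup v i) (lookup u i)

  dot-⊕⊙ : ∀ {k} (v : Vec (Fin n) k) c e u → dot (v ⊕ᵥ c ⊙ᵥ e) u ≡ dot v u ⊕ (c ⊙ dot e u)
  dot-⊕⊙ []      c []      []      = sym (trans (R.+-identityˡ _) (R.zeroʳ c))
  dot-⊕⊙ (x ∷ v) c (y ∷ e) (z ∷ u) = begin
    ((x ⊕ (c ⊙ y)) ⊙ z) ⊕ dot (v ⊕ᵥ c ⊙ᵥ e) u
      ≡⟨ cong (((x ⊕ (c ⊙ y)) ⊙ z) ⊕_) (dot-⊕⊙ v c e u) ⟩
    ((x ⊕ (c ⊙ y)) ⊙ z) ⊕ (dot v u ⊕ (c ⊙ dot e u))
      ≡⟨ solve 6 (λ x c y z p q → (x :+ c :* y) :* z :+ (p :+ c :* q) := x :* z :+ p :+ c :*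
           (y :* z :+ q)) refl x c y z (dot v u) (dot e u) ⟩
    ((x ⊙ z) ⊕ dot v u) ⊕ (c ⊙ ((y ⊙ z) ⊕ dot e u))    ∎
    where open ≡-Reasoning

  Matrix : ℕ → ℕ → Set
  Matrix l k = Vec (Vec (Fin n) k) l

  tr : ∀ {k} → Matrix k k → Fin n
  tr X = R.sum λ i → lookup (lookup X i) i

  -- The rank-one update D + w eᵀ: the effect on the lower right block of adding multiples, with
  -- coefficients e, of the first column to the others.
  addOuter : ∀ {l k} → Vec (Fin n) l → Vec (Fin n) k → Matrix l k → Matrix l k
  addOuter w e D = zipWith (λ c r → r ⊕ᵥ c ⊙ᵥ e) w D

  block : ∀ {l k} → Fin n → Vec (Fin n) k → Vec (Fin n) l → Matrix l k → Matrix (suc l) (suc k)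
  block a v w D = (a ∷ v) ∷ zipWith _∷_ w D

  tr-block : ∀ {k} a v w (D : Matrix k k) → tr (block a v w D) ≡ a ⊕ tr D
  tr-block a v w D = cong (a ⊕_)
      (R.sum-cong-≗ λ i → cong (λ r → lookup r (suc i)) (Vecₚ.lookup-zipWith _∷_ i w D))

  tr-addOuter : ∀ {k} (w e : Vec (Fin n) k) D → tr (addOuter w e D) ≡ tr D ⊕ dot w e
  tr-addOuter {k} w e D = trans (R.sum-cong-≗ diag)
      (R.∑-distrib-+ (λ i → lookup (lookup D i) i) (λ i → lookup w i ⊙ lookup e i))
    where
    open ≡-Reasoning
    diag : ∀ i → lookup (lookup (addOuter w e D) i) i ≡ lookup (lookup D i) i ⊕ (lookup w i ⊙ lookup e i)
    diag i = begin
      lookup (lookup (addOuter w e D) i) i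
        ≡⟨ cong (λ r → lookup r i) (Vecₚ.lookup-zipWith _ i w D) ⟩
      lookup (lookup D i ⊕ᵥ lookup w i ⊙ᵥ e) i
        ≡⟨ Vecₚ.lookup-zipWith _⊕_ i (lookup D i) _ ⟩
      lookup (lookup D i) i ⊕ lookup (lookup w i ⊙ᵥ e) i
        ≡⟨ cong (lookup (lookup D i) i ⊕_) (Vecₚ.lookup-map i _ e) ⟩
      lookup (lookup D i) i ⊕ (lookup w i ⊙ lookup e i)    ∎

  -- Kernels under column and row operations

  Ker : ∀ {l k} → Matrix l k → Vec (Fin n) k → Set
  Ker X u = ∀ i → dot (lookup X i) u ≡ 𝟘

  -- Over a finite ring a square matrix with trivial kernel is invertible; unlike IsInvertible,
  -- this condition is visibly stable under row and column operations.
  Nonsingular : ∀ {l k} → Matrix l k → Set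
  Nonsingular X = ∀ u → Ker X u → u ≡ 𝟘ᵥ

  abstract
    -- Abstract, so that the search over all vectors never unfolds; the counts use only which
    -- proposition it decides.
    nonsingular? : ∀ {l k} (X : Matrix l k) → Dec (Nonsingular X)
    nonsingular? {l} {k} X = all-El? (vec (fin n) k) λ u →
      Finₚ.all? (λ i → dot (lookup X i) u Finₚ.≟ 𝟘) →-dec Vecₚ.≡-dec Finₚ._≟_ u 𝟘ᵥ

  module _ {l k} (a : Fin n) (v : Vec (Fin n) k) (w : Vec (Fin n) l) (D : Matrix l k) where

    row-suc : ∀ u i → dot (lookup (block a v w D) (suc i)) u ≡ dot (lookup w i ∷ lookup D i) u
    row-suc u i = cong (λ r → dot r u) (Vecₚ.lookup-zipWith _∷_ i w D)

    Ker-block⁺ : ∀ u → dot (a ∷ v) u ≡ 𝟘 → (∀ i → dot (lookup w i ∷ lookup D i) u ≡ 𝟘) → Ker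
        (block a v w D) u
    Ker-block⁺ u h t zero    = h
    Ker-block⁺ u h t (suc i) = trans (row-suc u i) (t i)

    Ker-block⁻ : ∀ u → Ker (block a v w D) u → ∀ i → dot (lookup w i ∷ lookup D i) u ≡ 𝟘
    Ker-block⁻ u κ i = trans (sym (row-suc u i)) (κ (suc i))

  -- A column operation on the matrix is the transposed operation on the vector: only the first
  -- coordinate changes, from x to x + e·u.
  dot-col : ∀ {k} c (r e : Vec (Fin n) k) x u →
            dot (c ∷ (r ⊕ᵥ c ⊙ᵥ e)) (x ∷ u) ≡ dot (c ∷ r) ((x ⊕ dot e u) ∷ u)
  dot-col c r e x u = trans (cong ((c ⊙ x) ⊕_) (dot-⊕⊙ r c e u))
    (solve 4 (λ c x p q → c :* x :+ (p :+ c :* q) := c :* (x :+ q) :+ p) refl c x (dot r u) (dot e u))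

  module _ {l k} (a : Fin n) (v : Vec (Fin n) k) (w : Vec (Fin n) l) (D : Matrix l k) (e : Vec (Fin n) k) where
    private
      X  = block a v w D
      X′ = block a (v ⊕ᵥ a ⊙ᵥ e) w (addOuter w e D)

      row-addOuter : ∀ x u i → dot (lookup w i ∷ lookup (addOuter w e D) i) (x ∷ u)
                             ≡ dot (lookup w i ∷ lookup D i) ((x ⊕ dot e u) ∷ u)
      row-addOuter x u i = trans
        (cong (λ r → dot (lookup w i ∷ r) (x ∷ u)) (Vecₚ.lookup-zipWith _ i w D))
        (dot-col (lookup w i) (lookup D i) e x u)

    nonsingular-col⁺ : Nonsingular X → Nonsingular X′
    nonsingular-col⁺ ns (x ∷ u) κ = cong₂ _∷_ x≡𝟘 u≡𝟘
      where
      xu≡𝟘 = ns ((x ⊕ dot e u) ∷ u) (Ker-block⁺ a v w D ((x ⊕ dot e u) ∷ u)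
        (trans (sym (dot-col a v e x u)) (κ zero))
        (λ i → trans (sym (row-addOuter x u i))
          (Ker-block⁻ a (v ⊕ᵥ a ⊙ᵥ e) w (addOuter w e D) (x ∷ u) κ i)))
      u≡𝟘 : u ≡ 𝟘ᵥ
      u≡𝟘 = Vecₚ.∷-injectiveʳ xu≡𝟘
      open ≡-Reasoning
      x≡𝟘 : x ≡ 𝟘
      x≡𝟘 = begin
        x             ≡⟨ R.+-identityʳ x ⟨
        x ⊕ 𝟘         ≡⟨ cong (x ⊕_) (dot-𝟘ʳ e) ⟨
        x ⊕ dot e 𝟘ᵥ  ≡⟨ cong (λ z → x ⊕ dot e z) u≡𝟘 ⟨
        x ⊕ dot e u   ≡⟨ Vecₚ.∷-injectiveˡ xu≡𝟘 ⟩
        𝟘             ∎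

    nonsingular-col⁻ : Nonsingular X′ → Nonsingular X
    nonsingular-col⁻ ns (x ∷ u) κ = cong₂ _∷_ x≡𝟘 u≡𝟘
      where
      -- The inverse of the substitution that turns kernel vectors of `X′` into kernel vectors of
      -- `X`.
      y = x ⊕ (⊖ dot e u)
      y+eu : y ⊕ dot e u ≡ x
      y+eu = ⊕-⊖-⊕ x (dot e u)
      yu≡𝟘 = ns (y ∷ u) (Ker-block⁺ a (v ⊕ᵥ a ⊙ᵥ e) w (addOuter w e D) (y ∷ u)
        (trans (dot-col a v e y u) (trans (cong (λ z → dot (a ∷ v) (z ∷ u)) y+eu) (κ zero)))
        (λ i → trans (row-addOuter y u i) (trans (cong (λ z → dot (lookup w i ∷ lookup D i) (z ∷ u)) y+eu)
                 (Ker-block⁻ a v w D (x ∷ u) κ i))))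
      u≡𝟘 : u ≡ 𝟘ᵥ
      u≡𝟘 = Vecₚ.∷-injectiveʳ yu≡𝟘
      open ≡-Reasoning
      x≡𝟘 : x ≡ 𝟘
      x≡𝟘 = begin
        x              ≡⟨ y+eu ⟨
        y ⊕ dot e u    ≡⟨ cong₂ (λ y u → y ⊕ dot e u) (Vecₚ.∷-injectiveˡ yu≡𝟘) u≡𝟘 ⟩
        𝟘 ⊕ dot e 𝟘ᵥ   ≡⟨ cong (𝟘 ⊕_) (dot-𝟘ʳ e) ⟩
        𝟘 ⊕ 𝟘          ≡⟨ R.+-identityˡ 𝟘 ⟩
        𝟘              ∎

  module _ {l k} (a : Fin n) (v : Vec (Fin n) k) (w : Vec (Fin n) l) (D : Matrix l k) (j : Fin l) where
    private
      X  = block a v w D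
      X′ = block (a ⊕ lookup w j) (lookup D j ⊕ᵥ v) w D

      row-add : ∀ x u → dot ((a ⊕ lookup w j) ∷ (lookup D j ⊕ᵥ v)) (x ∷ u)
                      ≡ dot (a ∷ v) (x ∷ u) ⊕ dot (lookup w j ∷ lookup D j) (x ∷ u)
      row-add x u = begin
        ((a ⊕ c) ⊙ x) ⊕ dot (r ⊕ᵥ v) u
          ≡⟨ cong (((a ⊕ c) ⊙ x) ⊕_)
               (trans (R.sum-cong-≗ λ i → trans (cong (_⊙ lookup u i) (Vecₚ.lookup-zipWith _⊕_ i r v))
                 (R.distribʳ (lookup u i) _ _))
                   (R.∑-distrib-+ (λ i → lookup r i ⊙ lookup u i) (λ i → lookup v i ⊙ lookup u i))) ⟩
        ((a ⊕ c) ⊙ x) ⊕ (dot r u ⊕ dot v u)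
          ≡⟨ solve 5 (λ a c x p q → (a :+ c) :* x :+ (p :+ q) := a :* x :+ q :+ (c :* x :+ p))
               refl a c x (dot r u) (dot v u) ⟩
        ((a ⊙ x) ⊕ dot v u) ⊕ ((c ⊙ x) ⊕ dot r u)     ∎
        where
        open ≡-Reasoning
        c = lookup w j
        r = lookup D j

    -- The kernels agree: the lower rows are unchanged, and the two top rows differ by a lower row,
    -- which vanishes on any kernel vector.
    nonsingular-row⁺ : Nonsingular X → Nonsingular X′
    nonsingular-row⁺ ns (x ∷ u) κ = ns (x ∷ u) (Ker-block⁺ a v w D (x ∷ u) top rows)
      where
      rows = Ker-block⁻ (a ⊕ lookup w j) (lookup D j ⊕ᵥ v) w D (x ∷ u) κ
      top : dot (a ∷ v) (x ∷ u) ≡ 𝟘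
      top = trans (sym (R.+-identityʳ _))
          (trans (cong (dot (a ∷ v) (x ∷ u) ⊕_) (sym (rows j))) (trans (sym (row-add x u)) (κ zero)))

    nonsingular-row⁻ : Nonsingular X′ → Nonsingular X
    nonsingular-row⁻ ns (x ∷ u) κ = ns (x ∷ u)
      (Ker-block⁺ (a ⊕ lookup w j) (lookup D j ⊕ᵥ v) w D (x ∷ u)
        (trans (row-add x u) (trans (cong₂ _⊕_ (κ zero) (rows j)) (R.+-identityˡ 𝟘))) rows)
      where
      rows = Ker-block⁻ a v w D (x ∷ u) κ

  module _ {k} (a a⁻¹ : Fin n) (aa⁻¹ : a ⊙ a⁻¹ ≡ 𝟙) (w : Vec (Fin n) k) (D : Matrix k k) where

    -- The top equation reads a x = 0 and forces x = 0; then w drops out of the other equations.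
    nonsingular-pivot⁺ : Nonsingular D → Nonsingular (block a 𝟘ᵥ w D)
    nonsingular-pivot⁺ ns (x ∷ u) κ = cong₂ _∷_ x≡𝟘 u≡𝟘
      where
      open ≡-Reasoning
      x≡𝟘 : x ≡ 𝟘
      x≡𝟘 = begin
        x                                    ≡⟨ R.*-identityʳ x ⟨
        x ⊙ 𝟙                                ≡⟨ cong (x ⊙_) aa⁻¹ ⟨
        x ⊙ (a ⊙ a⁻¹)
          ≡⟨ solve 3 (λ x a b → x :* (a :* b) := b :* (a :* x)) refl x a a⁻¹ ⟩
        a⁻¹ ⊙ (a ⊙ x)                        ≡⟨ cong (a⁻¹ ⊙_) (R.+-identityʳ _) ⟨
        a⁻¹ ⊙ ((a ⊙ x) ⊕ 𝟘)
          ≡⟨ cong (λ z → a⁻¹ ⊙ ((a ⊙ x) ⊕ z)) (trans (dot-comm 𝟘ᵥ u) (dot-𝟘ʳ u)) ⟨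
        a⁻¹ ⊙ dot (a ∷ 𝟘ᵥ) (x ∷ u)           ≡⟨ cong (a⁻¹ ⊙_) (κ zero) ⟩
        a⁻¹ ⊙ 𝟘                              ≡⟨ R.zeroʳ a⁻¹ ⟩
        𝟘                                    ∎
      u≡𝟘 : u ≡ 𝟘ᵥ
      u≡𝟘 = ns u λ i → begin
        dot (lookup D i) u                         ≡⟨ R.+-identityˡ _ ⟨
        𝟘 ⊕ dot (lookup D i) u
          ≡⟨ cong (_⊕ dot (lookup D i) u) (trans (cong (lookup w i ⊙_) x≡𝟘) (R.zeroʳ (lookup w i))) ⟨
        (lookup w i ⊙ x) ⊕ dot (lookup D i) u      ≡⟨ Ker-block⁻ a 𝟘ᵥ w D (x ∷ u) κ i ⟩
        𝟘                                          ∎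

    nonsingular-pivot⁻ : Nonsingular (block a 𝟘ᵥ w D) → Nonsingular D
    nonsingular-pivot⁻ ns u κ = Vecₚ.∷-injectiveʳ (ns (𝟘 ∷ u) (Ker-block⁺ a 𝟘ᵥ w D (𝟘 ∷ u)
      (trans (cong₂ _⊕_ (R.zeroʳ a) (trans (dot-comm 𝟘ᵥ u) (dot-𝟘ʳ u))) (R.+-identityˡ 𝟘))
      (λ i → trans (cong₂ _⊕_ (R.zeroʳ (lookup w i)) (κ i)) (R.+-identityˡ 𝟘))))

  -- The maximal ideal

  Nil : Fin n → Set
  Nil x = σ ⊙ x ≡ 𝟘

  Nil? : ∀ x → Dec (Nil x)
  Nil? x = σ ⊙ x Finₚ.≟ 𝟘

  -- The vector (σ, 0, ..., 0) only meets the first column, which σ annihilates.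
  nil-col-singular : ∀ {l k} a (v : Vec (Fin n) k) (w : Vec (Fin n) l) D →
                     Nil a → All Nil w → ¬ Nonsingular (block a v w D)
  nil-col-singular a v w D a∈ w∈ ns = σ≢𝟘 (Vecₚ.∷-injectiveˡ (ns (σ ∷ 𝟘ᵥ) (Ker-block⁺ a v w D (σ ∷ 𝟘ᵥ)
      (kill a∈ v) (λ i → kill (Allₚ.lookup⁺ w∈ i) (lookup D i)))))
    where
    kill : ∀ {k c} → Nil c → (r : Vec (Fin n) k) → dot (c ∷ r) (σ ∷ 𝟘ᵥ) ≡ 𝟘
    kill {c = c} σc≡𝟘 r = trans (cong₂ _⊕_ (trans (R.*-comm c σ) σc≡𝟘) (dot-𝟘ʳ r)) (R.+-identityˡ 𝟘)

  Nil-𝟘 : Nil 𝟘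
  Nil-𝟘 = R.zeroʳ σ

  ¬Nil-𝟙 : ¬ Nil 𝟙
  ¬Nil-𝟙 σ𝟙≡𝟘 = σ≢𝟘 (trans (sym (R.*-identityʳ σ)) σ𝟙≡𝟘)

  Nil-⊕ : ∀ {x y} → Nil x → Nil y → Nil (x ⊕ y)
  Nil-⊕ {x} {y} x∈ y∈ = trans (R.distribˡ σ x y) (trans (cong₂ _⊕_ x∈ y∈) (R.+-identityˡ 𝟘))

  Nil-⊙ : ∀ {x} c → Nil x → Nil (c ⊙ x)
  Nil-⊙ {x} c x∈ = trans (solve 3 (λ s c x → s :* (c :* x) := c :* (s :* x)) refl σ c x)
                         (trans (cong (c ⊙_) x∈) (R.zeroʳ c))

  Nil-⊖ : ∀ {x} → Nil x → Nil (⊖ x)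
  Nil-⊖ {x} x∈ = trans (sym (R.-‿distribʳ-* σ x)) (trans (cong ⊖_ x∈) R.-0#≈0#)

  Nil-dot : ∀ {k} {w : Vec (Fin n) k} → All Nil w → ∀ v → Nil (dot w v)
  Nil-dot []        []      = Nil-𝟘
  Nil-dot (_∷_ {x = y} x∈ w∈) (x ∷ v) = Nil-⊕ (subst Nil (R.*-comm x y) (Nil-⊙ x x∈)) (Nil-dot w∈ v)

  Nil-cancel : ∀ {x y} → Nil (x ⊕ y) → Nil x → Nil y
  Nil-cancel {x} {y} xy∈ x∈ = subst Nil (trans (cong (_⊕ (⊖ x)) (R.+-comm x y)) (⊕-⊕-⊖ y x))
      (Nil-⊕ xy∈ (Nil-⊖ x∈))

  ¬Nil⇒¬Nil-⊕ : ∀ {x y} → ¬ Nil x → Nil y → ¬ Nil (x ⊕ y)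
  ¬Nil⇒¬Nil-⊕ {x} {y} x∉ y∈ xy∈ = x∉ (Nil-cancel (subst Nil (R.+-comm x y) xy∈) y∈)

  -- A single unit entry suffices: e is its inverse times c in that position and zero elsewhere.
  solve-dot : ∀ {k} (w : Vec (Fin n) k) → ¬ All Nil w → ∀ c → ∃ λ e → dot w e ≡ c
  solve-dot []      w∉ c = ⊥-elim (w∉ [])
  solve-dot (x ∷ w) w∉ c with Nil? x
  ... | yes x∈ = let e , we≡c = solve-dot w (λ w∈ → w∉ (x∈ ∷ w∈)) c in
                 𝟘 ∷ e , trans (cong₂ _⊕_ (R.zeroʳ x) we≡c) (R.+-identityˡ c)
  ... | no x∉  = let y , xy≡𝟙 = unit x x∉ in
                 (y ⊙ c) ∷ 𝟘ᵥ , trans (cong₂ _⊕_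
                   (trans (sym (R.*-assoc x y c)) (trans (cong (_⊙ c) xy≡𝟙) (R.*-identityˡ c)))
                     (dot-𝟘ʳ w)) (R.+-identityʳ c)

  ¬All-Nil : ∀ {k} (w : Vec (Fin n) k) → ¬ All Nil w → ∃ λ j → ¬ Nil (lookup w j)
  ¬All-Nil []      w∉ = ⊥-elim (w∉ [])
  ¬All-Nil (x ∷ w) w∉ with Nil? x
  ... | yes x∈ = let j , wⱼ∉ = ¬All-Nil w (λ w∈ → w∉ (x∈ ∷ w∈)) in suc j , wⱼ∉
  ... | no x∉  = zero , x∉

  -- Invariance of sums under translation and reflection

  ∑-⊕ : ∀ c f → ∑ (fin n) (λ x → f (x ⊕ c)) ≡ ∑ (fin n) f
  ∑-⊕ c = ∑-permute (_⊕ c) (_⊕ (⊖ c)) (λ x → ⊕-⊖-⊕ x c) (λ x → ⊕-⊕-⊖ x c)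

  ∑-reflect : ∀ c f → ∑ (fin n) (λ x → f (c ⊕ (⊖ x))) ≡ ∑ (fin n) f
  ∑-reflect c = ∑-permute (λ x → c ⊕ (⊖ x)) (λ x → c ⊕ (⊖ x)) invol invol
    where
    open ≡-Reasoning
    invol : ∀ x → c ⊕ (⊖ (c ⊕ (⊖ x))) ≡ x
    invol x = begin
      c ⊕ (⊖ (c ⊕ (⊖ x)))        ≡⟨ cong (c ⊕_) (R.-‿+-comm c (⊖ x)) ⟨
      c ⊕ ((⊖ c) ⊕ (⊖ (⊖ x)))    ≡⟨ cong (λ z → c ⊕ ((⊖ c) ⊕ z)) (R.-‿involutive x) ⟩
      c ⊕ ((⊖ c) ⊕ x)            ≡⟨ R.+-assoc c (⊖ c) x ⟨
      (c ⊕ (⊖ c)) ⊕ x            ≡⟨ cong (_⊕ x) (R.-‿inverseʳ c) ⟩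
      𝟘 ⊕ x                      ≡⟨ R.+-identityˡ x ⟩
      x                          ∎

  ∑-⊕ᵥ : ∀ {k} (e : Vec (Fin n) k) f → ∑ (vec (fin n) k) (λ v → f (v ⊕ᵥ e)) ≡ ∑ (vec (fin n) k) f
  ∑-⊕ᵥ []      f = refl
  ∑-⊕ᵥ (c ∷ e) f = trans (∑-cong (fin n) λ x → ∑-⊕ᵥ e (f ∘ ((x ⊕ c) ∷_))) (∑-⊕ c _)

  -- With w and e fixed, the update translates each row by a constant vector, so it permutes the
  -- matrices.
  ∑-addOuter : ∀ {l k} (w : Vec (Fin n) l) (e : Vec (Fin n) k) f →
               ∑ (vec (vec (fin n) k) l) (λ D → f (addOuter w e D)) ≡ ∑ (vec (vec (fin n) k) l) f
  ∑-addOuter         []      e f = refl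
  ∑-addOuter {suc l} {k} (c ∷ w) e f =
    trans (∑-cong (vec (fin n) k) λ r → ∑-addOuter w e (f ∘ ((r ⊕ᵥ c ⊙ᵥ e) ∷_))) (∑-⊕ᵥ (c ⊙ᵥ e) _)

  -- Sums over nonsingular matrices, sorted by first column

  mat : ℕ → Shape
  mat k = vec (vec (fin n) k) k

  -- A general weight on the trace treats both counts at once: a point mass gives the matrices of
  -- one trace, the constant 1 gives the order of the group.
  trSum : ∀ k → (Fin n → ℕ) → ℕ
  trSum k g = ∑ (mat k) λ X → ind (nonsingular? X) * g (tr X)

  trSum-cong : ∀ k {g h} → (∀ t → g t ≡ h t) → trSum k g ≡ trSum k h
  trSum-cong k g≗h = ∑-cong (mat k) λ X → cong (ind (nonsingular? X) *_) (g≗h (tr X))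

  colSum : ∀ {k} → (Fin n → ℕ) → Fin n → Vec (Fin n) k → ℕ
  colSum {k} g a w = ∑ (vec (fin n) k) λ v → ∑ (mat k) λ D →
    ind (nonsingular? (block a v w D)) * g (a ⊕ tr D)

  colSum-cong : ∀ {k g h} a (w : Vec (Fin n) k) → (∀ t → g t ≡ h t) → colSum g a w ≡ colSum h a w
  colSum-cong {k} a w g≗h = ∑-cong (vec (fin n) k) λ v → ∑-cong (mat k) λ D →
    cong (ind (nonsingular? (block a v w D)) *_) (g≗h (a ⊕ tr D))

  trSum-suc : ∀ k g → trSum (suc k) g ≡ ∑ (fin n) λ a → ∑ (vec (fin n) k) λ w → colSum g a w
  trSum-suc k g = ∑-cong (fin n) λ a → begin
    ∑ (vec (fin n) k) (λ v → ∑ (vec (vec (fin n) (suc k)) k) λ E → h ((a ∷ v) ∷ E))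
      ≡⟨ ∑-cong (vec (fin n) k) (λ v → ∑-zipWith-∷ (fin n) k k λ E → h ((a ∷ v) ∷ E)) ⟩
    ∑ (vec (fin n) k) (λ v → ∑ (vec (fin n) k) λ w → ∑ (mat k) λ D → h (block a v w D))
      ≡⟨ ∑-swap (vec (fin n) k) (vec (fin n) k) _ ⟩
    ∑ (vec (fin n) k) (λ w → ∑ (vec (fin n) k) λ v → ∑ (mat k) λ D → h (block a v w D))
      ≡⟨ ∑-cong (vec (fin n) k) (λ w → ∑-cong (vec (fin n) k) λ v → ∑-cong (mat k) λ D →
           cong (λ t → ind (nonsingular? (block a v w D)) * g t) (tr-block a v w D)) ⟩
    ∑ (vec (fin n) k) (λ w → colSum g a w) ∎
    where
    open ≡-Reasoning
    h : Matrix (suc k) (suc k) → ℕ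
    h X = ind (nonsingular? X) * g (tr X)

  -- The substitution v ↦ v + a e, D ↦ D + w eᵀ permutes the completions of the column, keeps
  -- nonsingularity and moves the trace by w·e.
  colSum-col : ∀ {k} g a (w e : Vec (Fin n) k) → colSum g a w ≡ colSum (λ t → g (t ⊕ dot w e)) a w
  colSum-col {k} g a w e = begin
    ∑ (vec (fin n) k) (λ v → ∑ (mat k) λ D → h v D)
      ≡⟨ ∑-⊕ᵥ (a ⊙ᵥ e) (λ v → ∑ (mat k) λ D → h v D) ⟨
    ∑ (vec (fin n) k) (λ v → ∑ (mat k) λ D → h (v ⊕ᵥ a ⊙ᵥ e) D)
      ≡⟨ ∑-cong (vec (fin n) k) (λ v → sym (∑-addOuter w e (h (v ⊕ᵥ a ⊙ᵥ e)))) ⟩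
    ∑ (vec (fin n) k) (λ v → ∑ (mat k) λ D → h (v ⊕ᵥ a ⊙ᵥ e) (addOuter w e D))
      ≡⟨ ∑-cong (vec (fin n) k) (λ v → ∑-cong (mat k) λ D → cong₂ _*_
           (ind-cong (nonsingular? _) (nonsingular? _) (nonsingular-col⁻ a v w D e)
             (nonsingular-col⁺ a v w D e))
           (cong g (trans (cong (a ⊕_) (tr-addOuter w e D)) (sym (R.+-assoc a _ _))))) ⟩
    colSum (λ t → g (t ⊕ dot w e)) a w ∎
    where
    open ≡-Reasoning
    h : Vec (Fin n) k → Matrix k k → ℕ
    h v D = ind (nonsingular? (block a v w D)) * g (a ⊕ tr D)

  -- Adding a lower row to the top row can turn a nonunit pivot into a unit. This changes the trace
  -- along with the pivot, hence the constant weight.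
  colSum-row : ∀ {k} a (w : Vec (Fin n) k) j → colSum (λ _ → 1) a w ≡ colSum (λ _ → 1) (a ⊕ lookup w j) w
  colSum-row {k} a w j = begin
    colSum (λ _ → 1) a w
      ≡⟨ ∑-cong (vec (fin n) k) (λ v → ∑-cong (mat k) λ D → cong (_* 1)
           (ind-cong (nonsingular? _) (nonsingular? _)
             (λ ns → subst (λ v → Nonsingular (block _ v w D)) (⊕ᵥ-comm _ v)
               (nonsingular-row⁺ a v w D j ns))
             (λ ns → nonsingular-row⁻ a v w D j
               (subst (λ v → Nonsingular (block _ v w D)) (⊕ᵥ-comm v _) ns)))) ⟩
    ∑ (vec (fin n) k) (λ v → ∑ (mat k) λ D → h (v ⊕ᵥ lookup D j) D)
      -- The translation of v depends on D, so D must be fixed first.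
      ≡⟨ ∑-swap (vec (fin n) k) (mat k) (λ v D → h (v ⊕ᵥ lookup D j) D) ⟩
    ∑ (mat k) (λ D → ∑ (vec (fin n) k) λ v → h (v ⊕ᵥ lookup D j) D)
      ≡⟨ ∑-cong (mat k) (λ D → ∑-⊕ᵥ (lookup D j) (λ v → h v D)) ⟩
    ∑ (mat k) (λ D → ∑ (vec (fin n) k) λ v → h v D)
      ≡⟨ ∑-swap (vec (fin n) k) (mat k) h ⟨
    colSum (λ _ → 1) (a ⊕ lookup w j) w ∎
    where
    open ≡-Reasoning
    ⊕ᵥ-comm : ∀ (u v : Vec (Fin n) k) → u ⊕ᵥ v ≡ v ⊕ᵥ u
    ⊕ᵥ-comm = Vecₚ.zipWith-comm R.+-comm
    h : Vec (Fin n) k → Matrix k k → ℕ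
    h v D = ind (nonsingular? (block (a ⊕ lookup w j) v w D)) * 1

  colSum-nil : ∀ {k} g a (w : Vec (Fin n) k) → Nil a → All Nil w → colSum g a w ≡ 0
  colSum-nil {k} g a w a∈ w∈ = trans
    (∑-cong (vec (fin n) k) λ v → trans
      (∑-cong (mat k) λ D → cong (_* g (a ⊕ tr D))
        (ind-no (nonsingular? _) (nil-col-singular a v w D a∈ w∈)))
      (∑-zero (mat k)))
    (∑-zero (vec (fin n) k))

  -- Substituting D + w (a⁻¹ v)ᵀ for D makes the new D the Schur complement: the column operation
  -- with e = a⁻¹ v builds v from a zero top row, and the trace picks up w·(a⁻¹ v).
  colSum-unit : ∀ {k} g a a⁻¹ (w : Vec (Fin n) k) → a ⊙ a⁻¹ ≡ 𝟙 →
    colSum g a w ≡ ∑ (vec (fin n) k) λ v → trSum k λ t → g (a ⊕ (t ⊕ dot w (a⁻¹ ⊙ᵥ v)))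
  colSum-unit {k} g a a⁻¹ w aa⁻¹≡𝟙 = ∑-cong (vec (fin n) k) λ v → begin
    ∑ (mat k) (h v)
      ≡⟨ ∑-addOuter w (a⁻¹ ⊙ᵥ v) (h v) ⟨
    ∑ (mat k) (λ D → h v (addOuter w (a⁻¹ ⊙ᵥ v) D))
      ≡⟨ ∑-cong (mat k) (λ D → cong₂ _*_
           (ind-cong (nonsingular? _) (nonsingular? _)
             (λ ns → nonsingular-pivot⁻ a a⁻¹ aa⁻¹≡𝟙 w D (nonsingular-col⁻ a 𝟘ᵥ w D (a⁻¹ ⊙ᵥ v)
               (subst (λ v′ → Nonsingular (block a v′ w (addOuter w (a⁻¹ ⊙ᵥ v) D))) (sym (col-v v)) ns)))
             (λ ns → subst (λ v′ → Nonsingular (block a v′ w (addOuter w (a⁻¹ ⊙ᵥ v) D))) (col-v v)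
               (nonsingular-col⁺ a 𝟘ᵥ w D (a⁻¹ ⊙ᵥ v) (nonsingular-pivot⁺ a a⁻¹ aa⁻¹≡𝟙 w D ns))))
           (cong (λ t → g (a ⊕ t)) (tr-addOuter w (a⁻¹ ⊙ᵥ v) D))) ⟩
    trSum k (λ t → g (a ⊕ (t ⊕ dot w (a⁻¹ ⊙ᵥ v)))) ∎
    where
    open ≡-Reasoning
    h : Vec (Fin n) k → Matrix k k → ℕ
    h v D = ind (nonsingular? (block a v w D)) * g (a ⊕ tr D)
    col-v : ∀ {k} (v : Vec (Fin n) k) → 𝟘ᵥ ⊕ᵥ a ⊙ᵥ (a⁻¹ ⊙ᵥ v) ≡ v
    col-v []      = refl
    col-v (x ∷ v) = cong₂ _∷_
      (trans (R.+-identityˡ _) (trans (sym (R.*-assoc a a⁻¹ x))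
        (trans (cong (_⊙ x) aa⁻¹≡𝟙) (R.*-identityˡ x))))
      (col-v v)

  -- Counts at a given trace

  δ : Fin n → Fin n → ℕ
  δ b t = ind (t Finₚ.≟ b)

  count : ℕ → Fin n → ℕ
  count k b = trSum k (δ b)

  total : ℕ → ℕ
  total k = trSum k (λ _ → 1)

  nils : ℕ
  nils = ∑ (fin n) (ind ∘ Nil?)

  ∑-all-Nil : ∀ k → ∑ (vec (fin n) k) (λ w → ind (all? Nil? w)) ≡ nils ^ k
  ∑-all-Nil k = ∑-∏ (fin n) k (ind ∘ Nil?) (λ w → ind (all? Nil? w)) refl λ x w →
    trans (ind-cong (all? Nil? (x ∷ w)) (Nil? x ×-dec all? Nil? w) (λ { (x∈ ∷ w∈) → x∈ , w∈ })
      (λ { (x∈ , w∈) → x∈ ∷ w∈ }))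
          (ind-× (Nil? x) (all? Nil? w))

  ⊕-solveʳ : ∀ {x y c} → x ⊕ c ≡ y → x ≡ y ⊕ (⊖ c)
  ⊕-solveʳ {x} {y} {c} eq = trans (sym (⊕-⊕-⊖ x c)) (cong (_⊕ (⊖ c)) eq)

  δ-translate : ∀ b c t → δ b (t ⊕ c) ≡ δ (b ⊕ (⊖ c)) t
  δ-translate b c t = ind-cong (t ⊕ c Finₚ.≟ b) (t Finₚ.≟ b ⊕ (⊖ c)) ⊕-solveʳ
    λ eq → trans (cong (_⊕ c) eq) (⊕-⊖-⊕ b c)

  -- Some e has w·e = b₁ - b₀, and the column operation with this e carries one trace to the other.
  colSum-δ-unimodular : ∀ {k} b₀ b₁ a (w : Vec (Fin n) k) → ¬ All Nil w → colSum (δ b₀) a w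
      ≡ colSum (δ b₁) a w
  colSum-δ-unimodular b₀ b₁ a w w∉ = let e , we≡ = solve-dot w w∉ ((⊖ b₀) ⊕ b₁) in sym (begin
    colSum (δ b₁) a w                    ≡⟨ colSum-col (δ b₁) a w e ⟩
    colSum (λ t → δ b₁ (t ⊕ dot w e)) a w
      ≡⟨ colSum-cong a w (λ t → trans (cong (λ c → δ b₁ (t ⊕ c)) we≡)
           (ind-cong (_ Finₚ.≟ _) (_ Finₚ.≟ _) (fwd t) (bwd t))) ⟩
    colSum (δ b₀) a w                    ∎)
    where
    open ≡-Reasoning
    bwd : ∀ t → t ≡ b₀ → t ⊕ ((⊖ b₀) ⊕ b₁) ≡ b₁
    bwd t refl = trans (sym (R.+-assoc t (⊖ t) b₁))
        (trans (cong (_⊕ b₁) (R.-‿inverseʳ t)) (R.+-identityˡ b₁))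
    fwd : ∀ t → t ⊕ ((⊖ b₀) ⊕ b₁) ≡ b₁ → t ≡ b₀
    fwd t eq = R.+-cancelʳ ((⊖ b₀) ⊕ b₁) t b₀ (trans eq (sym (bwd b₀ refl)))

  colSum-δ-unit : ∀ {k} b a (w : Vec (Fin n) k) m → ¬ Nil a → All Nil w →
    (∀ c → Nil c → count k ((b ⊕ (⊖ a)) ⊕ c) ≡ m) → colSum (δ b) a w ≡ n ^ k * m
  colSum-δ-unit {k} b a w m a∉ w∈ count≡m = let a⁻¹ , aa⁻¹≡𝟙 = unit a a∉ in begin
    colSum (δ b) a w
      ≡⟨ colSum-unit (δ b) a a⁻¹ w aa⁻¹≡𝟙 ⟩
    ∑ (vec (fin n) k) (λ v → trSum k λ t → δ b (a ⊕ (t ⊕ dot w (a⁻¹ ⊙ᵥ v))))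
      ≡⟨ ∑-cong (vec (fin n) k) (λ v → trans
           (trSum-cong k λ t → trans (cong (δ b) (R.+-comm a _))
             (trans (δ-translate b a _) (δ-translate (b ⊕ (⊖ a)) _ t)))
           (count≡m _ (Nil-⊖ (Nil-dot w∈ (a⁻¹ ⊙ᵥ v))))) ⟩
    ∑ (vec (fin n) k) (λ _ → m)
      ≡⟨ ∑-vec-const n k m ⟩
    n ^ k * m ∎
    where open ≡-Reasoning

  module _ {k U V} (count-nil : ∀ b → Nil b → count k b ≡ V) (count-unit : ∀ b → ¬ Nil b → count k b ≡ U)
           {b₀ b₁} (b₀∈ : Nil b₀) (b₁∉ : ¬ Nil b₁) where

    -- The comparison of the two traces column by column. The correction is present only if w
    -- consists of nonunits and b₁ - a is a nonunit; there the left count is nᵏ U and the right one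
    -- nᵏ V, so adding V and U on opposite sides balances them.
    colSum-δ-compare : ∀ a (w : Vec (Fin n) k) →
      colSum (δ b₀) a w + ind (all? Nil? w) * (ind (Nil? (b₁ ⊕ (⊖ a))) * (n ^ k * V)) ≡
      colSum (δ b₁) a w + ind (all? Nil? w) * (ind (Nil? (b₁ ⊕ (⊖ a))) * (n ^ k * U))
    colSum-δ-compare a w with all? Nil? w
    ... | no w∉ = cong (_+ 0) (colSum-δ-unimodular b₀ b₁ a w w∉)
    ... | yes w∈ with Nil? a
    ...   | yes a∈ = cong₂ _+_
              (trans (colSum-nil (δ b₀) a w a∈ w∈) (sym (colSum-nil (δ b₁) a w a∈ w∈)))
              (trans (cong (λ i → 1 * (i * (n ^ k * V))) b₁-a)
                (sym (cong (λ i → 1 * (i * (n ^ k * U))) b₁-a)))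
              where
              b₁-a : ind (Nil? (b₁ ⊕ (⊖ a))) ≡ 0
              b₁-a = ind-no (Nil? _) (¬Nil⇒¬Nil-⊕ b₁∉ (Nil-⊖ a∈))
    ...   | no a∉ with Nil? (b₁ ⊕ (⊖ a)) 
    ...     | yes b₁-a∈ = begin
              colSum (δ b₀) a w + 1 * (1 * (n ^ k * V))
                ≡⟨ cong₂ _+_ left (trans (ℕₚ.*-identityˡ _) (ℕₚ.*-identityˡ _)) ⟩
              n ^ k * U + n ^ k * V                     ≡⟨ ℕₚ.+-comm (n ^ k * U) _ ⟩
              n ^ k * V + n ^ k * U
                ≡⟨ cong₂ _+_ right (trans (ℕₚ.*-identityˡ _) (ℕₚ.*-identityˡ _)) ⟨
              colSum (δ b₁) a w + 1 * (1 * (n ^ k * U)) ∎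
              where
              open ≡-Reasoning
              -- b₀ is a nonunit and a a unit, so b₀ - a is a unit.
              left  = colSum-δ-unit b₀ a w U a∉ w∈ λ c c∈ → count-unit _
                        (¬Nil⇒¬Nil-⊕ (λ b₀-a∈ → a∉
                          (subst Nil (R.-‿involutive a) (Nil-⊖ (Nil-cancel b₀-a∈ b₀∈)))) c∈)
              right = colSum-δ-unit b₁ a w V a∉ w∈ λ c c∈ → count-nil _ (Nil-⊕ b₁-a∈ c∈)
    ...     | no b₁-a∉ = cong (_+ 0) (trans left (sym right))
              where
              left  = colSum-δ-unit b₀ a w U a∉ w∈ λ c c∈ → count-unit _
                        (¬Nil⇒¬Nil-⊕ (λ b₀-a∈ → a∉
                          (subst Nil (R.-‿involutive a) (Nil-⊖ (Nil-cancel b₀-a∈ b₀∈)))) c∈)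
              right = colSum-δ-unit b₁ a w U a∉ w∈ λ c c∈ → count-unit _ (¬Nil⇒¬Nil-⊕ b₁-a∉ c∈)

    -- A difference of counts, with both sides moved so that no subtraction occurs.
    count-compare : count (suc k) b₀ + nils ^ suc k * (n ^ k * V) ≡ count
        (suc k) b₁ + nils ^ suc k * (n ^ k * U)
    count-compare = begin
      count (suc k) b₀ + nils ^ suc k * (n ^ k * V)                         ≡⟨ sym (split b₀ V) ⟩
      ∑ (fin n) (λ a → ∑ (vec (fin n) k) λ w → colSum (δ b₀) a w + h V a w)
        ≡⟨ ∑-cong (fin n) (λ a → ∑-cong (vec (fin n) k) λ w → colSum-δ-compare a w) ⟩
      ∑ (fin n) (λ a → ∑ (vec (fin n) k) λ w → colSum (δ b₁) a w + h U a w) ≡⟨ split b₁ U ⟩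
      count (suc k) b₁ + nils ^ suc k * (n ^ k * U)                         ∎
      where
      open ≡-Reasoning
      h : ℕ → Fin n → Vec (Fin n) k → ℕ
      h W a w = ind (all? Nil? w) * (ind (Nil? (b₁ ⊕ (⊖ a))) * (n ^ k * W))
      ∑-h : ∀ W → ∑ (fin n) (λ a → ∑ (vec (fin n) k) (h W a)) ≡ nils ^ suc k * (n ^ k * W)
      ∑-h W = begin
        ∑ (fin n) (λ a → ∑ (vec (fin n) k) (h W a))
          ≡⟨ ∑-cong (fin n) (λ a → trans (∑-*ʳ (vec (fin n) k) _ _)
               (cong (_* (ind (Nil? (b₁ ⊕ (⊖ a))) * (n ^ k * W))) (∑-all-Nil k))) ⟩
        ∑ (fin n) (λ a → nils ^ k * (ind (Nil? (b₁ ⊕ (⊖ a))) * (n ^ k * W)))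
          ≡⟨ ∑-*ˡ (fin n) (nils ^ k) _ ⟩
        nils ^ k * ∑ (fin n) (λ a → ind (Nil? (b₁ ⊕ (⊖ a))) * (n ^ k * W))
          ≡⟨ cong (nils ^ k *_) (∑-*ʳ (fin n) (n ^ k * W) _) ⟩
        nils ^ k * (∑ (fin n) (λ a → ind (Nil? (b₁ ⊕ (⊖ a)))) * (n ^ k * W))
          -- The reflection a ↦ b₁ - a matches these pivots with the nonunits.
          ≡⟨ cong (λ z → nils ^ k * (z * (n ^ k * W))) (∑-reflect b₁ (ind ∘ Nil?)) ⟩
        nils ^ k * (nils * (n ^ k * W))
          ≡⟨ trans (sym (ℕₚ.*-assoc (nils ^ k) nils _))
               (cong (_* (n ^ k * W)) (ℕₚ.*-comm (nils ^ k) nils)) ⟩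
        nils ^ suc k * (n ^ k * W) ∎
      split : ∀ b W → ∑ (fin n) (λ a → ∑ (vec (fin n) k) λ w → colSum (δ b) a w + h W a w)
                    ≡ count (suc k) b + nils ^ suc k * (n ^ k * W)
      split b W = begin
        ∑ (fin n) (λ a → ∑ (vec (fin n) k) λ w → colSum (δ b) a w + h W a w)
          ≡⟨ ∑-cong (fin n) (λ a → ∑-+ (vec (fin n) k) (colSum (δ b) a) (h W a)) ⟩
        ∑ (fin n) (λ a → ∑ (vec (fin n) k) (colSum (δ b) a) + ∑ (vec (fin n) k) (h W a))
          ≡⟨ ∑-+ (fin n) _ _ ⟩
        ∑ (fin n) (λ a → ∑ (vec (fin n) k) (colSum (δ b) a)) + ∑ (fin n) (λ a → ∑ (vec (fin n) k) (h W a))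
          ≡⟨ cong₂ _+_ (sym (trSum-suc k (δ b))) (∑-h W) ⟩
        count (suc k) b + nils ^ suc k * (n ^ k * W) ∎

  trSum-0 : ∀ g → trSum 0 g ≡ g 𝟘
  trSum-0 g = trans (cong (_* g 𝟘) (ind-yes (nonsingular? []) (λ { [] _ → refl }))) (ℕₚ.*-identityˡ (g 𝟘))

  count-1 : ∀ b → count 1 b ≡ ind (¬? (Nil? b))
  count-1 b = begin
    count 1 b                                                 ≡⟨ trSum-suc 0 (δ b) ⟩
    ∑ (fin n) (λ a → colSum (δ b) a [])                       ≡⟨ ∑-cong (fin n) pointwise ⟩
    ∑ (fin n) (λ a → ind (a Finₚ.≟ b) * ind (¬? (Nil? b)))    ≡⟨ ∑-*ʳ (fin n) _ _ ⟩
    ∑ (fin n) (λ a → ind (a Finₚ.≟ b)) * ind (¬? (Nil? b))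
      ≡⟨ cong (_* ind (¬? (Nil? b))) (∑-δ n b) ⟩
    1 * ind (¬? (Nil? b))                                     ≡⟨ ℕₚ.*-identityˡ _ ⟩
    ind (¬? (Nil? b))                                         ∎
    where
    open ≡-Reasoning
    pointwise : ∀ a → colSum (δ b) a [] ≡ ind (a Finₚ.≟ b) * ind (¬? (Nil? b))
    pointwise a with Nil? a
    ... | yes a∈ = trans (colSum-nil (δ b) a [] a∈ [])
        (sym (trans (sym (ind-× (a Finₚ.≟ b) (¬? (Nil? b))))
                     (ind-no (a Finₚ.≟ b ×-dec ¬? (Nil? b)) λ { (refl , a∉) → a∉ a∈ })))
    ... | no a∉ = let a⁻¹ , aa⁻¹≡𝟙 = unit a a∉ in begin
      colSum (δ b) a []                        ≡⟨ colSum-unit (δ b) a a⁻¹ [] aa⁻¹≡𝟙 ⟩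
      trSum 0 (λ t → δ b (a ⊕ (t ⊕ 𝟘)))        ≡⟨ trSum-0 (λ t → δ b (a ⊕ (t ⊕ 𝟘))) ⟩
      δ b (a ⊕ (𝟘 ⊕ 𝟘))
        ≡⟨ cong (δ b) (trans (cong (a ⊕_) (R.+-identityˡ 𝟘)) (R.+-identityʳ a)) ⟩
      ind (a Finₚ.≟ b)
        ≡⟨ ind-cong (a Finₚ.≟ b) (a Finₚ.≟ b ×-dec ¬? (Nil? b)) (λ { refl → refl , a∉ }) proj₁ ⟩
      ind (a Finₚ.≟ b ×-dec ¬? (Nil? b))       ≡⟨ ind-× (a Finₚ.≟ b) (¬? (Nil? b)) ⟩
      ind (a Finₚ.≟ b) * ind (¬? (Nil? b))     ∎

  -- In the step the correction terms do not depend on b₀ or b₁. Comparing two nonunits with the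
  -- same unit 1, or two units with the same nonunit 0, therefore lets them cancel.
  count-class : ∀ k → (∀ b → Nil b → count (suc k) b ≡ count (suc k) 𝟘) ×
      (∀ b → ¬ Nil b → count (suc k) b ≡ count (suc k) 𝟙)
  count-class zero =
    (λ b b∈ → trans (count-1 b)
      (trans (ind-cong (¬? (Nil? b)) (¬? (Nil? 𝟘)) (λ b∉ → ⊥-elim (b∉ b∈)) (λ 𝟘∉ → ⊥-elim (𝟘∉ Nil-𝟘)))
        (sym (count-1 𝟘)))) ,
    (λ b b∉ → trans (count-1 b)
      (trans (ind-cong (¬? (Nil? b)) (¬? (Nil? 𝟙)) (λ _ → ¬Nil-𝟙) (λ _ → b∉)) (sym (count-1 𝟙))))
  count-class (suc k) =
    (λ b b∈ → ℕₚ.+-cancelʳ-≡ _ _ _ (trans (compare b∈ ¬Nil-𝟙) (sym (compare Nil-𝟘 ¬Nil-𝟙)))) ,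
    (λ b b∉ → ℕₚ.+-cancelʳ-≡ _ _ _ (trans (sym (compare Nil-𝟘 b∉)) (compare Nil-𝟘 ¬Nil-𝟙)))
    where
    compare : ∀ {b₀ b₁} → Nil b₀ → ¬ Nil b₁ →
      count (2 + k) b₀ + nils ^ (2 + k) * (n ^ suc k * count (suc k) 𝟘) ≡
      count (2 + k) b₁ + nils ^ (2 + k) * (n ^ suc k * count (suc k) 𝟙)
    compare b₀∈ b₁∉ = count-compare {suc k} (proj₁ (count-class k)) (proj₂ (count-class k)) b₀∈ b₁∉

  count-step : ∀ k →
    count (2 + k) 𝟘 + nils ^ (2 + k) * (n ^ suc k * count (suc k) 𝟘) ≡
    count (2 + k) 𝟙 + nils ^ (2 + k) * (n ^ suc k * count (suc k) 𝟙)
  count-step k = count-compare {suc k} (proj₁ (count-class k)) (proj₂ (count-class k)) Nil-𝟘 ¬Nil-𝟙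

  -- Every first column with a unit entry has the same number of completions: if the unit sits in w
  -- and not in a, adding its row to the top row makes the pivot a unit. The second summand stands
  -- in for the columns without units, which have no completions.
  colSum-total : ∀ {k} a (w : Vec (Fin n) k) →
    colSum (λ _ → 1) a w + ind (Nil? a) * (ind (all? Nil? w) * (n ^ k * total k)) ≡ n ^ k * total k
  colSum-total {k} a w = go
    where
    unit-pivot : ∀ a → ¬ Nil a → colSum (λ _ → 1) a w ≡ n ^ k * total k
    unit-pivot a a∉ = let a⁻¹ , aa⁻¹≡𝟙 = unit a a∉ in
      trans (colSum-unit (λ _ → 1) a a⁻¹ w aa⁻¹≡𝟙) (∑-vec-const n k (total k))
    go : colSum (λ _ → 1) a w + ind (Nil? a) * (ind (all? Nil? w) * (n ^ k * total k)) ≡ n ^ k * total k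
    go with Nil? a
    ... | no a∉ = trans (ℕₚ.+-identityʳ _) (unit-pivot a a∉)
    ... | yes a∈ with all? Nil? w
    ...   | yes w∈ = trans (cong₂ _+_ (colSum-nil (λ _ → 1) a w a∈ w∈) (ℕₚ.*-identityˡ _))
        (ℕₚ.*-identityˡ _)
    ...   | no w∉ = let j , wⱼ∉ = ¬All-Nil w w∉ in trans (ℕₚ.+-identityʳ _)
              (trans (colSum-row a w j) (unit-pivot (a ⊕ lookup w j) λ a+wⱼ∈ → wⱼ∉ (Nil-cancel a+wⱼ∈ a∈)))

  total-step : ∀ k → total (suc k) + nils ^ suc k * (n ^ k * total k) ≡ n ^ suc k * (n ^ k * total k)
  total-step k = begin
    total (suc k) + nils ^ suc k * T
      ≡⟨ cong₂ _+_ (trSum-suc k (λ _ → 1)) (sym ∑-h) ⟩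
    ∑ (fin n) (λ a → ∑ (vec (fin n) k) (colSum (λ _ → 1) a)) + ∑ (fin n) (λ a → ∑ (vec (fin n) k) (h a))
      ≡⟨ ∑-+ (fin n) _ _ ⟨
    ∑ (fin n) (λ a → ∑ (vec (fin n) k) (colSum (λ _ → 1) a) + ∑ (vec (fin n) k) (h a))
      ≡⟨ ∑-cong (fin n) (λ a → sym (∑-+ (vec (fin n) k) (colSum (λ _ → 1) a) (h a))) ⟩
    ∑ (fin n) (λ a → ∑ (vec (fin n) k) λ w → colSum (λ _ → 1) a w + h a w)
      ≡⟨ ∑-cong (fin n) (λ a → trans (∑-cong (vec (fin n) k) (colSum-total a)) (∑-vec-const n k T)) ⟩
    ∑ (fin n) (λ _ → n ^ k * T)
      ≡⟨ trans (∑-fin-const n _) (sym (ℕₚ.*-assoc n (n ^ k) T)) ⟩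
    n ^ suc k * T ∎
    where
    open ≡-Reasoning
    T = n ^ k * total k
    h : Fin n → Vec (Fin n) k → ℕ
    h a w = ind (Nil? a) * (ind (all? Nil? w) * T)
    ∑-h : ∑ (fin n) (λ a → ∑ (vec (fin n) k) (h a)) ≡ nils ^ suc k * T
    ∑-h = begin
      ∑ (fin n) (λ a → ∑ (vec (fin n) k) (h a))
        ≡⟨ ∑-cong (fin n) (λ a → trans (∑-*ˡ (vec (fin n) k) (ind (Nil? a)) _)
             (cong (ind (Nil? a) *_) (trans (∑-*ʳ (vec (fin n) k) T _) (cong (_* T) (∑-all-Nil k))))) ⟩
      ∑ (fin n) (λ a → ind (Nil? a) * (nils ^ k * T))
        ≡⟨ ∑-*ʳ (fin n) (nils ^ k * T) (ind ∘ Nil?) ⟩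
      nils * (nils ^ k * T)
        ≡⟨ ℕₚ.*-assoc nils (nils ^ k) T ⟨
      nils ^ suc k * T ∎

  ∑-count : ∀ k → ∑ (fin n) (count k) ≡ total k
  ∑-count k = begin
    ∑ (fin n) (λ b → ∑ (mat k) λ X → ind (nonsingular? X) * δ b (tr X))
      ≡⟨ ∑-swap (fin n) (mat k) _ ⟩
    ∑ (mat k) (λ X → ∑ (fin n) λ b → ind (nonsingular? X) * δ b (tr X))
      ≡⟨ ∑-cong (mat k) (λ X → trans (∑-*ˡ (fin n) (ind (nonsingular? X)) (λ b → δ b (tr X)))
           (cong (ind (nonsingular? X) *_)
           (trans (∑-cong (fin n) λ b → ind-cong (tr X Finₚ.≟ b) (b Finₚ.≟ tr X) sym sym)
             (∑-δ n (tr X))))) ⟩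
    total k ∎
    where open ≡-Reasoning

  -- Obtained by summing over all traces as if each were a unit and then correcting at the nonunits.
  total-count : ∀ k → total (suc k) + nils * count (suc k) 𝟙 ≡ n * count
      (suc k) 𝟙 + nils * count (suc k) 𝟘
  total-count k = begin
    total (suc k) + nils * U
      ≡⟨ cong₂ _+_ (sym (∑-count (suc k))) (sym (∑-*ʳ (fin n) U (ind ∘ Nil?))) ⟩
    ∑ (fin n) (count (suc k)) + ∑ (fin n) (λ b → ind (Nil? b) * U)
      ≡⟨ ∑-+ (fin n) _ _ ⟨
    ∑ (fin n) (λ b → count (suc k) b + ind (Nil? b) * U)
      ≡⟨ ∑-cong (fin n) pointwise ⟩
    ∑ (fin n) (λ b → U + ind (Nil? b) * V)
      ≡⟨ ∑-+ (fin n) _ _ ⟩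
    ∑ (fin n) (λ _ → U) + ∑ (fin n) (λ b → ind (Nil? b) * V)
      ≡⟨ cong₂ _+_ (∑-fin-const n U) (∑-*ʳ (fin n) V (ind ∘ Nil?)) ⟩
    n * U + nils * V ∎
    where
    open ≡-Reasoning
    U = count (suc k) 𝟙
    V = count (suc k) 𝟘
    pointwise : ∀ b → count (suc k) b + ind (Nil? b) * U ≡ U + ind (Nil? b) * V
    pointwise b with Nil? b
    ... | yes b∈ = trans (cong₂ _+_ (proj₁ (count-class k) b b∈) (ℕₚ.*-identityˡ U))
                         (trans (ℕₚ.+-comm V U) (cong (U +_) (sym (ℕₚ.*-identityˡ V))))
    ... | no b∉  = cong (_+ 0) (proj₂ (count-class k) b b∉)

-- The ring ℤ/n on Fin n

module _ (n : ℕ) .{{_ : NonZero n}} where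

  toℕ-mod : ∀ x → toℕ (x mod n) ≡ x % n
  toℕ-mod x = Finₚ.toℕ-fromℕ< _

  mod-cong-% : ∀ {x y} → x % n ≡ y % n → x mod n ≡ y mod n
  mod-cong-% eq = Finₚ.toℕ-injective (trans (toℕ-mod _) (trans eq (sym (toℕ-mod _))))

  toℕ-mod-inverse : ∀ (a : Fin n) → toℕ a mod n ≡ a
  toℕ-mod-inverse a = Finₚ.toℕ-injective (trans (toℕ-mod _) (m<n⇒m%n≡m (Finₚ.toℕ<n a)))

  infixl 6 _⊕ₙ_
  infixl 7 _⊙ₙ_

  _⊕ₙ_ _⊙ₙ_ : Fin n → Fin n → Fin n
  a ⊕ₙ b = (toℕ a + toℕ b) mod n
  a ⊙ₙ b = (toℕ a * toℕ b) mod n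

  ⊖ₙ_ : Fin n → Fin n
  ⊖ₙ a = (n ∸ toℕ a) mod n

  mod-+ : ∀ x y → (x mod n) ⊕ₙ (y mod n) ≡ (x + y) mod n
  mod-+ x y = mod-cong-% (trans (cong₂ (λ u v → (u + v) % n) (toℕ-mod x) (toℕ-mod y))
      (sym (%-distribˡ-+ x y n)))

  mod-* : ∀ x y → (x mod n) ⊙ₙ (y mod n) ≡ (x * y) mod n
  mod-* x y = mod-cong-% (trans (cong₂ (λ u v → (u * v) % n) (toℕ-mod x) (toℕ-mod y))
      (sym (%-distribˡ-* x y n)))

  private
    -- Absorbs an inner reduction, so that each ring axiom falls back on its counterpart in ℕ.
    +-mod : ∀ a y → a ⊕ₙ (y mod n) ≡ (toℕ a + y) mod n
    +-mod a y = trans (cong (_⊕ₙ (y mod n)) (sym (toℕ-mod-inverse a))) (mod-+ (toℕ a) y)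

    *-mod : ∀ a y → a ⊙ₙ (y mod n) ≡ (toℕ a * y) mod n
    *-mod a y = trans (cong (_⊙ₙ (y mod n)) (sym (toℕ-mod-inverse a))) (mod-* (toℕ a) y)

    ⊕-comm : ∀ a b → a ⊕ₙ b ≡ b ⊕ₙ a
    ⊕-comm a b = cong (_mod n) (ℕₚ.+-comm (toℕ a) (toℕ b))

    ⊙-comm : ∀ a b → a ⊙ₙ b ≡ b ⊙ₙ a
    ⊙-comm a b = cong (_mod n) (ℕₚ.*-comm (toℕ a) (toℕ b))

    ⊕-assoc : ∀ a b c → (a ⊕ₙ b) ⊕ₙ c ≡ a ⊕ₙ (b ⊕ₙ c)
    ⊕-assoc a b c = begin
      (a ⊕ₙ b) ⊕ₙ c                     ≡⟨ ⊕-comm (a ⊕ₙ b) c ⟩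
      c ⊕ₙ (a ⊕ₙ b)                     ≡⟨ +-mod c _ ⟩
      (toℕ c + (toℕ a + toℕ b)) mod n
        ≡⟨ cong (_mod n) (trans (ℕₚ.+-comm (toℕ c) _) (ℕₚ.+-assoc (toℕ a) _ _)) ⟩
      (toℕ a + (toℕ b + toℕ c)) mod n   ≡⟨ +-mod a _ ⟨
      a ⊕ₙ (b ⊕ₙ c)                     ∎
      where open ≡-Reasoning

    ⊙-assoc : ∀ a b c → (a ⊙ₙ b) ⊙ₙ c ≡ a ⊙ₙ (b ⊙ₙ c)
    ⊙-assoc a b c = begin
      (a ⊙ₙ b) ⊙ₙ c                     ≡⟨ ⊙-comm (a ⊙ₙ b) c ⟩
      c ⊙ₙ (a ⊙ₙ b)                     ≡⟨ *-mod c _ ⟩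
      (toℕ c * (toℕ a * toℕ b)) mod n
        ≡⟨ cong (_mod n) (trans (ℕₚ.*-comm (toℕ c) _) (ℕₚ.*-assoc (toℕ a) _ _)) ⟩
      (toℕ a * (toℕ b * toℕ c)) mod n   ≡⟨ *-mod a _ ⟨
      a ⊙ₙ (b ⊙ₙ c)                     ∎
      where open ≡-Reasoning

    ⊕-identityʳ : ∀ a → a ⊕ₙ (0 mod n) ≡ a
    ⊕-identityʳ a = trans (+-mod a 0) (trans (cong (_mod n) (ℕₚ.+-identityʳ (toℕ a))) (toℕ-mod-inverse a))

    ⊙-identityʳ : ∀ a → a ⊙ₙ (1 mod n) ≡ a
    ⊙-identityʳ a = trans (*-mod a 1) (trans (cong (_mod n) (ℕₚ.*-identityʳ (toℕ a))) (toℕ-mod-inverse a))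

    ⊖-inverseʳ : ∀ a → a ⊕ₙ (⊖ₙ a) ≡ 0 mod n
    ⊖-inverseʳ a = trans (+-mod a (n ∸ toℕ a)) (mod-cong-% (trans
      (cong (_% n) (ℕₚ.m+[n∸m]≡n (ℕₚ.<⇒≤ (Finₚ.toℕ<n a))))
        (trans (n%n≡0 n) (sym (m<n⇒m%n≡m (ℕ.>-nonZero⁻¹ n))))))

    ⊙-distribˡ : ∀ a b c → a ⊙ₙ (b ⊕ₙ c) ≡ (a ⊙ₙ b) ⊕ₙ (a ⊙ₙ c)
    ⊙-distribˡ a b c = begin
      a ⊙ₙ (b ⊕ₙ c)                             ≡⟨ *-mod a _ ⟩
      (toℕ a * (toℕ b + toℕ c)) mod n           ≡⟨ cong (_mod n) (ℕₚ.*-distribˡ-+ (toℕ a) _ _) ⟩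
      (toℕ a * toℕ b + toℕ a * toℕ c) mod n     ≡⟨ mod-+ _ _ ⟨
      (a ⊙ₙ b) ⊕ₙ (a ⊙ₙ c)                      ∎
      where open ≡-Reasoning

  isCommutativeRingₙ : IsCommutativeRing _≡_ _⊕ₙ_ _⊙ₙ_ ⊖ₙ_ (0 mod n) (1 mod n)
  isCommutativeRingₙ = record
    { isRing = record
      { +-isAbelianGroup = record
        { isGroup = record
          { isMonoid = record
            { isSemigroup = record
              { isMagma = record { isEquivalence = isEquivalence ; ∙-cong = cong₂ _⊕ₙ_ }
              ; assoc = ⊕-assoc }
            ; identity = (λ a → trans (⊕-comm _ a) (⊕-identityʳ a)) , ⊕-identityʳ }
          ; inverse = (λ a → trans (⊕-comm _ a) (⊖-inverseʳ a)) , ⊖-inverseʳ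
          ; ⁻¹-cong = cong ⊖ₙ_ }
        ; comm = ⊕-comm }
      ; *-cong = cong₂ _⊙ₙ_
      ; *-assoc = ⊙-assoc
      ; *-identity = (λ a → trans (⊙-comm _ a) (⊙-identityʳ a)) , ⊙-identityʳ
      ; distrib = ⊙-distribˡ , λ a b c → trans (⊙-comm (b ⊕ₙ c) a)
          (trans (⊙-distribˡ a b c) (cong₂ _⊕ₙ_ (⊙-comm a b) (⊙-comm a c))) }
    ; *-comm = ⊙-comm }

-- Below the top row the entries compute to one recursive call of the local function, which thereby
-- becomes the witness.
idMat-rows : ∀ n .{{_ : NonZero n}} r → ∃ λ (f : Fin r → Fin r → ℕ) →
  tail (idMat {n} {suc r}) ≡ tabulate (λ i → (0 mod n) ∷ tabulate (λ j → f i j mod n))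
idMat-rows n r = _ , refl

-- The local function δ of idMat cannot be named from outside Defs.  It is recovered by unification
-- instead: abstracting suc r separates the matrix size from the index bound of idMat-rows, which
-- leaves a constraint that determines the underscore uniquely.
mutual
  δ-idMat : ∀ n .{{_ : NonZero n}} r {k} → Fin k → Fin k → ℕ
  δ-idMat = _

  δ-idMat-unique : ∀ n .{{_ : NonZero n}} r i j → proj₁ (idMat-rows n r) i j ≡ δ-idMat n (suc r) i j
  δ-idMat-unique n r i j with suc r
  ... | _ = refl

-- Counting multiples, the pigeonhole principle, coprimality to prime powers

∑-split : ∀ a b (f : ℕ → ℕ) → ∑ (fin (a + b)) (f ∘ toℕ) ≡ ∑ (fin a) (f ∘ toℕ) + ∑ (fin b)
    (λ x → f (a + toℕ x))
∑-split zero    b f = refl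
∑-split (suc a) b f = trans (cong (f 0 +_) (∑-split a b (f ∘ suc))) (sym (ℕₚ.+-assoc (f 0) _ _))

-- Each block of p consecutive numbers contains one multiple, its first element.
∑-multiples : ∀ p q .{{_ : NonZero p}} → ∑ (fin (q * p)) (λ x → ind (p ∣? toℕ x)) ≡ q
∑-multiples p       zero    = refl
∑-multiples (suc p) (suc q) = begin
  ∑ (fin (suc p + q * suc p)) (λ x → f (toℕ x))
    ≡⟨ ∑-split (suc p) (q * suc p) f ⟩
  f 0 + ∑ (fin p) (λ x → f (suc (toℕ x))) + ∑ (fin (q * suc p)) (λ x → f (suc p + toℕ x))
    ≡⟨ cong₂ _+_ (cong₂ _+_ (ind-yes (suc p ∣? 0) (suc p ∣0))
         (trans (∑-cong (fin p) small) (∑-zero (fin p))))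
         (trans (∑-cong (fin (q * suc p)) shift) (∑-multiples (suc p) q)) ⟩
  suc q ∎
  where
  open ≡-Reasoning
  f : ℕ → ℕ
  f x = ind (suc p ∣? x)
  small : ∀ (x : Fin p) → f (suc (toℕ x)) ≡ 0
  small x = ind-no (suc p ∣? suc (toℕ x)) λ p∣x → ℕₚ.<⇒≱ (s≤s (Finₚ.toℕ<n x)) (∣⇒≤ p∣x)
  shift : ∀ (x : Fin (q * suc p)) → f (suc p + toℕ x) ≡ f (toℕ x)
  shift x = ind-cong (suc p ∣? suc p + toℕ x) (suc p ∣? toℕ x) (λ p∣ → ∣m+n∣m⇒∣n p∣ ∣-refl)
      (∣m∣n⇒∣m+n ∣-refl)

-- A missed y would extend f to an injection from N + 1 elements into N.
injective⇒hits : ∀ {N} (f : Fin N → Fin N) → (∀ {i j} → f i ≡ f j → i ≡ j) → ∀ y → ∃ λ x → f x ≡ y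
injective⇒hits {N} f inj y with Finₚ.any? (λ x → f x Finₚ.≟ y)
... | yes hit = hit
... | no miss = ⊥-elim (ℕₚ.1+n≰n (Finₚ.injective⇒≤ {f = g} g-inj))
  where
  g : Fin (suc N) → Fin N
  g zero    = y
  g (suc i) = f i
  g-inj : ∀ {i j} → g i ≡ g j → i ≡ j
  g-inj {zero}  {zero}  eq = refl
  g-inj {zero}  {suc j} eq = ⊥-elim (miss (j , sym eq))
  g-inj {suc i} {zero}  eq = ⊥-elim (miss (i , eq))
  g-inj {suc i} {suc j} eq = cong suc (inj eq)

-- The enumeration of `El S` comes from the cardinality of a sum with one-point fibres.
injective⇒surjective : ∀ S (f : El S → El S) → (∀ {x y} → f x ≡ f y → x ≡ y) → ∀ y → ∃ λ x → f x ≡ y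
injective⇒surjective S f inj y =
  let i , eq = injective⇒hits (λ i → enc (f (dec i)))
        (λ eq → trans (sym (enc∘dec _)) (trans (cong enc (inj (enc-inj eq))) (enc∘dec _))) (enc y)
  in dec i , enc-inj eq
  where
  e = HasCard-∑ S {B = λ _ → ⊤} (λ x → HasCard-dec (yes tt) λ _ _ → refl)
  enc : El S → Fin (∑ S (λ _ → 1))
  enc x = Inverse.from e (x , tt)
  dec : Fin (∑ S (λ _ → 1)) → El S
  dec i = proj₁ (Inverse.to e i)
  enc∘dec : ∀ i → enc (dec i) ≡ i
  enc∘dec i = Inverse.strictlyInverseʳ e i
  enc-inj : ∀ {x y} → enc x ≡ enc y → x ≡ y
  enc-inj {x} {y} eq = trans (sym (cong proj₁ (Inverse.strictlyInverseˡ e (x , tt))))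
    (trans (cong (λ i → dec i) eq) (cong proj₁ (Inverse.strictlyInverseˡ e (y , tt))))

prime∤⇒coprime : ∀ {p x} → Prime p → ¬ p ∣ x → ∀ m → Coprime x (p ^ m)
prime∤⇒coprime         pp p∤x zero    (_ , d∣1) = ∣1⇒≡1 d∣1
prime∤⇒coprime {p} {x} pp p∤x (suc m) {d} (d∣x , d∣p*pᵐ) =
  prime∤⇒coprime pp p∤x m (d∣x , coprime-divisor d⊥p d∣p*pᵐ)
  where
  d⊥p : Coprime d p
  d⊥p {e} (e∣d , e∣p) with prime⇒irreducible pp e∣p
  ... | inj₁ e≡1 = e≡1
  ... | inj₂ e≡p = ⊥-elim (p∤x (subst (_∣ x) e≡p (∣-trans e∣d d∣x)))

mod≡0⇒∣ : ∀ {n} .{{_ : NonZero n}} x → x mod n ≡ 0 mod n → n ∣ x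
mod≡0⇒∣ {n} x eq = m%n≡0⇒n∣m x n (begin
  x % n          ≡⟨ toℕ-mod n x ⟨
  toℕ (x mod n)  ≡⟨ cong toℕ eq ⟩
  toℕ (0 mod n)  ≡⟨ toℕ-mod n 0 ⟩
  0 % n          ≡⟨ m<n⇒m%n≡m (ℕ.>-nonZero⁻¹ n) ⟩
  0              ∎)
  where open ≡-Reasoning

∣⇒mod≡0 : ∀ {n} .{{_ : NonZero n}} x → n ∣ x → x mod n ≡ 0 mod n
∣⇒mod≡0 {n} x n∣x = mod-cong-% n (trans (n∣m⇒m%n≡0 x n n∣x) (sym (m<n⇒m%n≡m (ℕ.>-nonZero⁻¹ n))))

-- Matrices over ℤ/pᵐ⁺¹

module PrimePower (p : ℕ) (pp : Prime p) (m : ℕ) where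

  -- Here `m` is one less than the exponent in the theorem, so that `p ^ m` is at once the
  -- annihilator σ and the number of nonunits.
  n : ℕ
  n = p ^ suc m

  instance
    p≢0 : NonZero p
    p≢0 = prime⇒nonZero pp

    n≢0 : NonZero n
    n≢0 = primePow≢0 pp (suc m)

    pᵐ≢0 : NonZero (p ^ m)
    pᵐ≢0 = primePow≢0 pp m

  σ : Fin n
  σ = (p ^ m) mod n

  toℕ-σ : toℕ σ ≡ p ^ m
  toℕ-σ = trans (toℕ-mod n (p ^ m))
      (m<n⇒m%n≡m (subst (p ^ m <_) (ℕₚ.*-comm (p ^ m) p)
        (ℕₚ.m<m*n (p ^ m) p (ℕ.nonTrivial⇒n>1 p {{prime⇒nonTrivial pp}}))))

  σ≢0 : σ ≢ 0 mod n
  σ≢0 eq = ℕ.≢-nonZero⁻¹ (p ^ m) (begin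
    p ^ m           ≡⟨ toℕ-σ ⟨
    toℕ σ           ≡⟨ cong toℕ eq ⟩
    toℕ (0 mod n)   ≡⟨ toℕ-mod n 0 ⟩
    0 % n           ≡⟨ m<n⇒m%n≡m (ℕ.>-nonZero⁻¹ n) ⟩
    0               ∎)
    where open ≡-Reasoning

  p∣⇒σ-kills : ∀ x → p ∣ toℕ x → _⊙ₙ_ n σ x ≡ 0 mod n
  p∣⇒σ-kills x p∣x = ∣⇒mod≡0 (toℕ σ * toℕ x)
    (subst₂ _∣_ (ℕₚ.*-comm (p ^ m) p) (cong (_* toℕ x) (sym toℕ-σ)) (*-monoʳ-∣ (p ^ m) p∣x))

  σ-kills⇒p∣ : ∀ x → _⊙ₙ_ n σ x ≡ 0 mod n → p ∣ toℕ x
  σ-kills⇒p∣ x eq = *-cancelˡ-∣ (p ^ m)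
    (subst₂ _∣_ (ℕₚ.*-comm p (p ^ m)) (cong (_* toℕ x) toℕ-σ) (mod≡0⇒∣ (toℕ σ * toℕ x) eq))

  private
    module Z where
      commutativeRing : CommutativeRing 0ℓ 0ℓ
      commutativeRing = record { isCommutativeRing = isCommutativeRingₙ n }
      open CommutativeRing commutativeRing public
      open Algebra.Properties.Semiring.Sum semiring public
      open Algebra.Properties.Ring ring public

  unit : ∀ x → _⊙ₙ_ n σ x ≢ 0 mod n → ∃ λ y → _⊙ₙ_ n x y ≡ 1 mod n
  unit x σx≢0 with coprime-Bézout (prime∤⇒coprime pp (σx≢0 ∘ p∣⇒σ-kills x) (suc m))
  ... | Bézout.+- a b eq = a mod n , (begin
    x Z.* (a mod n)                   ≡⟨ cong (Z._* (a mod n)) (toℕ-mod-inverse n x) ⟨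
    (toℕ x mod n) Z.* (a mod n)       ≡⟨ mod-* n (toℕ x) a ⟩
    (toℕ x * a) mod n                 ≡⟨ cong (_mod n) (trans (ℕₚ.*-comm (toℕ x) a) (sym eq)) ⟩
    (1 + b * n) mod n                 ≡⟨ mod-cong-% n ([m+kn]%n≡m%n 1 b n) ⟩
    1 mod n                           ∎)
    where open ≡-Reasoning
  -- Here 1 + a x is a multiple of n, so the inverse is -a.
  ... | Bézout.-+ a b eq = Z.- (a mod n) , (begin
    x Z.* (Z.- (a mod n))                            ≡⟨ Z.-‿distribʳ-* x (a mod n) ⟨
    Z.- (x Z.* (a mod n))                            ≡⟨ Z.+-identityˡ _ ⟨
    Z.0# Z.+ (Z.- (x Z.* (a mod n)))                 ≡⟨ cong (Z._+ (Z.- (x Z.* (a mod n)))) 1+xa ⟨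
    Z.1# Z.+ x Z.* (a mod n) Z.+ (Z.- (x Z.* (a mod n))) ≡⟨ Z.+-assoc Z.1# _ _ ⟩
    Z.1# Z.+ (x Z.* (a mod n) Z.+ (Z.- (x Z.* (a mod n)))) ≡⟨ cong (Z.1# Z.+_) (Z.-‿inverseʳ _) ⟩
    Z.1# Z.+ Z.0#                                    ≡⟨ Z.+-identityʳ Z.1# ⟩
    1 mod n                                          ∎)
    where
    open ≡-Reasoning
    1+xa : Z.1# Z.+ x Z.* (a mod n) ≡ Z.0#
    1+xa = begin
      Z.1# Z.+ x Z.* (a mod n)
        ≡⟨ cong (λ x → Z.1# Z.+ x Z.* (a mod n)) (toℕ-mod-inverse n x) ⟨
      Z.1# Z.+ (toℕ x mod n) Z.* (a mod n)     ≡⟨ cong (Z.1# Z.+_) (mod-* n (toℕ x) a) ⟩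
      Z.1# Z.+ ((toℕ x * a) mod n)             ≡⟨ mod-+ n 1 (toℕ x * a) ⟩
      (1 + toℕ x * a) mod n
        ≡⟨ cong (_mod n) (trans (cong suc (ℕₚ.*-comm (toℕ x) a)) eq) ⟩
      (b * n) mod n                            ≡⟨ ∣⇒mod≡0 (b * n) (n∣m*n b) ⟩
      0 mod n                                  ∎

  open LocalRing (_⊕ₙ_ n) (_⊙ₙ_ n) (⊖ₙ_ n) (0 mod n) (1 mod n) (isCommutativeRingₙ n) σ σ≢0 unit public

  nils≡ : nils ≡ p ^ m
  nils≡ = trans
    (∑-cong (fin n) λ x → ind-cong (Nil? x) (p ∣? toℕ x) (σ-kills⇒p∣ x) (p∣⇒σ-kills x))
    (trans (cong (λ N → ∑ (fin N) λ x → ind (p ∣? toℕ x)) (ℕₚ.*-comm p (p ^ m))) (∑-multiples p (p ^ m)))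

  gcd≡1⇒¬Nil : ∀ b → gcd (toℕ b) n ≡ 1 → ¬ Nil b
  gcd≡1⇒¬Nil b gcd≡1 b∈ = ℕ.nonTrivial⇒≢1 {{prime⇒nonTrivial pp}}
    (∣1⇒≡1 (subst (p ∣_) gcd≡1 (gcd-greatest (σ-kills⇒p∣ b b∈) (m∣m*n (p ^ m)))))

  gcd≢1⇒Nil : ∀ b → gcd (toℕ b) n ≢ 1 → Nil b
  gcd≢1⇒Nil b gcd≢1 with Nil? b
  ... | yes b∈ = b∈
  ... | no b∉  = ⊥-elim (gcd≢1 (coprime⇒gcd≡1 (prime∤⇒coprime pp (b∉ ∘ p∣⇒σ-kills b) (suc m))))

  -- Trace, product and identity matrix as ring sums

  sumFin-mod : ∀ r (f : Fin r → ℕ) → sumFin r f mod n ≡ Z.sum (λ i → f i mod n)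
  sumFin-mod zero    f = refl
  sumFin-mod (suc r) f = trans (sym (mod-+ n (f zero) _))
      (cong ((f zero mod n) Z.+_) (sumFin-mod r (f ∘ suc)))

  trace≡tr : ∀ {r} (X : Mat n r) → trace X ≡ tr X
  trace≡tr {r} X = trans (sumFin-mod r _) (Z.sum-cong-≗ λ i → toℕ-mod-inverse n (entry X i i))

  entry-⊗ : ∀ {r} (X Y : Mat n r) i k → entry (X ⊗ Y) i k ≡ Z.sum (λ j → entry X i j Z.* entry Y j k)
  entry-⊗ {r} X Y i k = trans
    (trans (cong (λ v → lookup v k) (Vecₚ.lookup∘tabulate _ i)) (Vecₚ.lookup∘tabulate _ k))
    (sumFin-mod r _)

  -- `r` is the matrix size that the local function of `idMat` carries along; it stays fixed while
  -- the index bound `k` drops in recursions.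
  kron : ∀ {r k} → Fin k → Fin k → Fin n
  kron {r} i j = δ-idMat n r i j mod n

  entry-idMat : ∀ {r} i j → entry (idMat {n} {r}) i j ≡ kron {r} i j
  entry-idMat i j = trans (cong (λ v → lookup v j) (Vecₚ.lookup∘tabulate _ i)) (Vecₚ.lookup∘tabulate _ j)

  ∑-0* : ∀ {k} (f : Fin k → Fin n) → Z.sum (λ j → Z.0# Z.* f j) ≡ Z.0#
  ∑-0* f = trans (sym (Z.*-distribˡ-sum Z.0# f)) (Z.zeroˡ _)

  kron-sumˡ : ∀ {r k} i (f : Fin k → Fin n) → Z.sum (λ j → kron {r} i j Z.* f j) ≡ f i
  kron-sumˡ     zero    f = trans (cong₂ Z._+_ (Z.*-identityˡ (f zero)) (∑-0* (f ∘ suc)))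
      (Z.+-identityʳ (f zero))
  kron-sumˡ {r} (suc i) f = trans (cong₂ Z._+_ (Z.zeroˡ (f zero)) (kron-sumˡ {r} i (f ∘ suc)))
      (Z.+-identityˡ (f (suc i)))

  kron-sym : ∀ {r k} (i j : Fin k) → kron {r} i j ≡ kron {r} j i
  kron-sym zero    zero    = refl
  kron-sym zero    (suc j) = refl
  kron-sym (suc i) zero    = refl
  kron-sym {r} (suc i) (suc j) = kron-sym {r} i j

  kron-sumʳ : ∀ {r k} i (f : Fin k → Fin n) → Z.sum (λ j → f j Z.* kron {r} j i) ≡ f i
  kron-sumʳ {r} i f = trans
      (Z.sum-cong-≗ λ j → trans (Z.*-comm (f j) _) (cong (Z._* f j) (kron-sym {r} j i)))
        (kron-sumˡ {r} i f)

  ∑-assoc : ∀ {k l} (f : Fin k → Fin n) (A : Fin k → Fin l → Fin n) (g : Fin l → Fin n) →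
    Z.sum (λ i → f i Z.* Z.sum (λ j → A i j Z.* g j)) ≡ Z.sum (λ j → Z.sum (λ i → f i Z.* A i j) Z.* g j)
  ∑-assoc f A g = begin
    Z.sum (λ i → f i Z.* Z.sum (λ j → A i j Z.* g j))
      ≡⟨ Z.sum-cong-≗ (λ i → Z.*-distribˡ-sum (f i) (λ j → A i j Z.* g j)) ⟩
    Z.sum (λ i → Z.sum (λ j → f i Z.* (A i j Z.* g j)))
      ≡⟨ Z.∑-comm (λ i j → f i Z.* (A i j Z.* g j)) ⟩
    Z.sum (λ j → Z.sum (λ i → f i Z.* (A i j Z.* g j)))
      ≡⟨ Z.sum-cong-≗ (λ j → trans (Z.sum-cong-≗ λ i → sym (Z.*-assoc (f i) (A i j) (g j)))
           (sym (Z.*-distribʳ-sum (g j) (λ i → f i Z.* A i j)))) ⟩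
    Z.sum (λ j → Z.sum (λ i → f i Z.* A i j) Z.* g j)     ∎
    where open ≡-Reasoning

  ⊗≡idMat⇒sum : ∀ {r} {X Y : Mat n r} → X ⊗ Y ≡ idMat → ∀ i k → Z.sum
      (λ j → entry X i j Z.* entry Y j k) ≡ kron {r} i k
  ⊗≡idMat⇒sum {r} {X} {Y} XY≡1 i k =
    trans (sym (entry-⊗ X Y i k)) (trans (cong (λ W → entry W i k) XY≡1) (entry-idMat {r} i k))

  mat-ext : ∀ {r} {X Y : Mat n r} → (∀ i j → entry X i j ≡ entry Y i j) → X ≡ Y
  mat-ext eq = Pointwise-≡⇒≡ (ext λ i → Pointwise-≡⇒≡ (ext λ j → eq i j))

  inverse-unique : ∀ {r} {X Y Y′ : Mat n r} → Y ⊗ X ≡ idMat → X ⊗ Y′ ≡ idMat → Y ≡ Y′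
  inverse-unique {r} {X} {Y} {Y′} YX≡1 XY′≡1 = mat-ext λ i k → begin
    entry Y i k
      ≡⟨ kron-sumʳ {r} k (entry Y i) ⟨
    Z.sum (λ j → entry Y i j Z.* kron {r} j k)
      ≡⟨ Z.sum-cong-≗ (λ j → cong (entry Y i j Z.*_) (sym (⊗≡idMat⇒sum {r} {X} {Y′} XY′≡1 j k))) ⟩
    Z.sum (λ j → entry Y i j Z.* Z.sum (λ l → entry X j l Z.* entry Y′ l k))
      ≡⟨ ∑-assoc (entry Y i) (entry X) (λ l → entry Y′ l k) ⟩
    Z.sum (λ l → Z.sum (λ j → entry Y i j Z.* entry X j l) Z.* entry Y′ l k)
      ≡⟨ Z.sum-cong-≗ (λ l → cong (Z._* entry Y′ l k) (⊗≡idMat⇒sum {r} {Y} {X} YX≡1 i l)) ⟩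
    Z.sum (λ l → kron {r} i l Z.* entry Y′ l k)
      ≡⟨ kron-sumˡ {r} i (λ l → entry Y′ l k) ⟩
    entry Y′ i k ∎
    where open ≡-Reasoning

  -- Ensures that a matrix is not counted once per proof of its invertibility: inverses are unique,
  -- and so are proofs of equations.
  isInvertible-irrelevant : ∀ {r} (X : Mat n r) → Irrelevant (IsInvertible X)
  isInvertible-irrelevant X (Y , XY , YX) (Y′ , XY′ , YX′) with inverse-unique {X = X} {Y} {Y′} YX XY′
  isInvertible-irrelevant X (Y , XY , YX) (Y , XY′ , YX′) | refl = cong₂ (λ a b → Y , a , b)
      (≡-irrelevant XY XY′) (≡-irrelevant YX YX′)

  -- u = (Y X) u = Y (X u) = 0.
  invertible⇒nonsingular : ∀ {r} (X : Mat n r) → IsInvertible X → Nonsingular X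
  invertible⇒nonsingular {r} X (Y , _ , YX≡1) u κ = Pointwise-≡⇒≡ (ext λ i → begin
    lookup u i
      ≡⟨ kron-sumˡ {r} i (lookup u) ⟨
    Z.sum (λ k → kron {r} i k Z.* lookup u k)
      ≡⟨ Z.sum-cong-≗ (λ k → cong (Z._* lookup u k) (sym (⊗≡idMat⇒sum {r} {Y} {X} YX≡1 i k))) ⟩
    Z.sum (λ k → Z.sum (λ j → entry Y i j Z.* entry X j k) Z.* lookup u k)
      ≡⟨ ∑-assoc (entry Y i) (entry X) (lookup u) ⟨
    Z.sum (λ j → entry Y i j Z.* dot (lookup X j) u)
      ≡⟨ Z.sum-cong-≗ (λ j → trans (cong (entry Y i j Z.*_) (κ j))
           (trans (Z.zeroʳ (entry Y i j)) (sym (Z.zeroˡ Z.0#)))) ⟩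
    Z.sum {r} (λ j → Z.0# Z.* Z.0#)
      ≡⟨ ∑-0* {r} (λ _ → Z.0#) ⟩
    Z.0#
      ≡⟨ Vecₚ.lookup-replicate i Z.0# ⟨
    lookup 𝟘ᵥ i ∎)
    where open ≡-Reasoning

  module _ {r} (X : Mat n r) (ns : Nonsingular X) where
    private
      act : Vec (Fin n) r → Vec (Fin n) r
      act u = map (λ row → dot row u) X

      act-injective : ∀ {u v} → act u ≡ act v → u ≡ v
      act-injective {u} {v} eq = Pointwise-≡⇒≡ (ext λ i → Z.x∙y⁻¹≈ε⇒x≈y _ _ (begin
        lookup u i Z.+ (Z.- lookup v i)
          ≡⟨ cong (lookup u i Z.+_) (Z.-1*x≈-x (lookup v i)) ⟨
        lookup u i Z.+ (Z.- Z.1#) Z.* lookup v i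
          ≡⟨ cong (lookup u i Z.+_) (Vecₚ.lookup-map i _ v) ⟨
        lookup u i Z.+ lookup ((Z.- Z.1#) ⊙ᵥ v) i          ≡⟨ Vecₚ.lookup-zipWith Z._+_ i u _ ⟨
        lookup (u ⊕ᵥ (Z.- Z.1#) ⊙ᵥ v) i                    ≡⟨ cong (λ d → lookup d i) d≡0 ⟩
        lookup 𝟘ᵥ i                                        ≡⟨ Vecₚ.lookup-replicate i Z.0# ⟩
        Z.0#                                               ∎))
        where
        open ≡-Reasoning
        -- The difference is written u + (-1) v so that `dot-⊕⊙` applies.
        d≡0 : u ⊕ᵥ (Z.- Z.1#) ⊙ᵥ v ≡ 𝟘ᵥ
        d≡0 = ns _ λ j → begin
          dot (lookup X j) (u ⊕ᵥ (Z.- Z.1#) ⊙ᵥ v)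
            ≡⟨ dot-comm (lookup X j) (u ⊕ᵥ (Z.- Z.1#) ⊙ᵥ v) ⟩
          dot (u ⊕ᵥ (Z.- Z.1#) ⊙ᵥ v) (lookup X j)
            ≡⟨ dot-⊕⊙ u (Z.- Z.1#) v (lookup X j) ⟩
          dot u (lookup X j) Z.+ (Z.- Z.1#) Z.* dot v (lookup X j)
            ≡⟨ cong₂ Z._+_ (dot-comm u (lookup X j))
                 (trans (Z.-1*x≈-x _) (cong Z.-_ (dot-comm v (lookup X j)))) ⟩
          dot (lookup X j) u Z.+ (Z.- dot (lookup X j) v)
            ≡⟨ cong (λ z → z Z.+ (Z.- dot (lookup X j) v))
                 (trans (sym (Vecₚ.lookup-map j _ X))
                   (trans (cong (λ w → lookup w j) eq) (Vecₚ.lookup-map j _ X))) ⟩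
          dot (lookup X j) v Z.+ (Z.- dot (lookup X j) v)     ≡⟨ Z.-‿inverseʳ _ ⟩
          Z.0#                                                ∎

      -- An injective action on a finite set is surjective; preimages of the unit vectors are the
      -- columns of a right inverse.
      column : ∀ k → ∃ λ u → act u ≡ tabulate (λ i → kron {r} i k)
      column k = injective⇒surjective (vec (fin n) r) act act-injective _

      Y : Mat n r
      Y = tabulate λ j → tabulate λ k → lookup (proj₁ (column k)) j

      entry-Y : ∀ j k → entry Y j k ≡ lookup (proj₁ (column k)) j
      entry-Y j k = trans (cong (λ v → lookup v k) (Vecₚ.lookup∘tabulate _ j)) (Vecₚ.lookup∘tabulate _ k)

      XY-sum : ∀ i k → Z.sum (λ j → entry X i j Z.* entry Y j k) ≡ kron {r} i k
      XY-sum i k = begin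
        Z.sum (λ j → entry X i j Z.* entry Y j k)
          ≡⟨ Z.sum-cong-≗ (λ j → cong (entry X i j Z.*_) (entry-Y j k)) ⟩
        dot (lookup X i) (proj₁ (column k))          ≡⟨ Vecₚ.lookup-map i _ X ⟨
        lookup (act (proj₁ (column k))) i            ≡⟨ cong (λ v → lookup v i) (proj₂ (column k)) ⟩
        lookup (tabulate (λ i → kron {r} i k)) i     ≡⟨ Vecₚ.lookup∘tabulate _ i ⟩
        kron {r} i k                                 ∎
        where open ≡-Reasoning

      columnYX columnId : Fin r → Vec (Fin n) r
      columnYX k = tabulate λ i → entry (Y ⊗ X) i k
      columnId k = tabulate λ i → kron {r} i k

      act-tabulate : ∀ f i → lookup (act (tabulate f)) i ≡ Z.sum (λ j → entry X i j Z.* f j)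
      act-tabulate f i = trans (Vecₚ.lookup-map i _ X)
          (Z.sum-cong-≗ λ j → cong (entry X i j Z.*_) (Vecₚ.lookup∘tabulate f j))

      -- The right inverse is also a left one: X (Y X) = (X Y) X = X, and X can be cancelled column
      -- by column because it acts injectively.
      columnYX≡ : ∀ k → columnYX k ≡ columnId k
      columnYX≡ k = act-injective (Pointwise-≡⇒≡ (ext λ i → begin
        lookup (act (columnYX k)) i
          ≡⟨ act-tabulate _ i ⟩
        Z.sum (λ j → entry X i j Z.* entry (Y ⊗ X) j k)
          ≡⟨ Z.sum-cong-≗ (λ j → cong (entry X i j Z.*_) (entry-⊗ Y X j k)) ⟩
        Z.sum (λ j → entry X i j Z.* Z.sum (λ l → entry Y j l Z.* entry X l k))
          ≡⟨ ∑-assoc (entry X i) (entry Y) (λ l → entry X l k) ⟩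
        Z.sum (λ l → Z.sum (λ j → entry X i j Z.* entry Y j l) Z.* entry X l k)
          ≡⟨ Z.sum-cong-≗ (λ l → cong (Z._* entry X l k) (XY-sum i l)) ⟩
        Z.sum (λ l → kron {r} i l Z.* entry X l k)
          ≡⟨ kron-sumˡ {r} i (λ l → entry X l k) ⟩
        entry X i k
          ≡⟨ kron-sumʳ {r} k (entry X i) ⟨
        Z.sum (λ j → entry X i j Z.* kron {r} j k)
          ≡⟨ act-tabulate _ i ⟨
        lookup (act (columnId k)) i ∎))
        where open ≡-Reasoning

    nonsingular⇒invertible : IsInvertible X
    nonsingular⇒invertible = Y ,
      mat-ext (λ i k → trans (entry-⊗ X Y i k) (trans (XY-sum i k) (sym (entry-idMat {r} i k)))) ,
      mat-ext (λ i k → trans (sym (Vecₚ.lookup∘tabulate _ i))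
          (trans (cong (λ v → lookup v i) (columnYX≡ k))
        (trans (Vecₚ.lookup∘tabulate _ i) (sym (entry-idMat {r} i k)))))

  isInvertible? : ∀ {r} (X : Mat n r) → Dec (IsInvertible X)
  isInvertible? X = map′ (nonsingular⇒invertible X) (invertible⇒nonsingular X) (nonsingular? X)

  HasCard-GLWithTrace : ∀ r b → HasCard (GLWithTrace n r b) (count r b)
  HasCard-GLWithTrace r b = subst (HasCard (GLWithTrace n r b))
    (∑-cong (mat r) λ X → trans (ind-× (isInvertible? X) (trace X Finₚ.≟ b)) (cong₂ _*_
      (ind-cong (isInvertible? X) (nonsingular? X) (invertible⇒nonsingular X) (nonsingular⇒invertible X))
      (cong (δ b) (trace≡tr X))))
    (HasCard-∑ (mat r) λ X → HasCard-dec (isInvertible? X ×-dec (trace X Finₚ.≟ b)) λ where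
      (inv , eq) (inv′ , eq′) → cong₂ _,_ (isInvertible-irrelevant X inv inv′) (≡-irrelevant eq eq′))

  -- The recurrences with explicit powers of p

  unit-count nil-count : ℕ → ℕ
  unit-count r = count r (1 mod n)
  nil-count  r = count r (0 mod n)

  unit-count-1 : unit-count 1 ≡ 1
  unit-count-1 = trans (count-1 _) (ind-yes (¬? (Nil? _)) ¬Nil-𝟙)

  nil-count-1 : nil-count 1 ≡ 0
  nil-count-1 = trans (count-1 _) (ind-no (¬? (Nil? _)) λ 𝟘∉ → 𝟘∉ Nil-𝟘)

  total-step′ : ∀ k → total (suc k) + (p ^ m) ^ suc k * (n ^ k * total k) ≡ n ^ suc k * (n ^ k * total k)
  total-step′ k = trans (cong (λ s → total (suc k) + s ^ suc k * (n ^ k * total k)) (sym nils≡))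
      (total-step k)

  count-step′ : ∀ k →
    nil-count (2 + k) + (p ^ m) ^ (2 + k) * (n ^ suc k * nil-count (suc k)) ≡
    unit-count (2 + k) + (p ^ m) ^ (2 + k) * (n ^ suc k * unit-count (suc k))
  count-step′ k = subst
    (λ s → nil-count (2 + k) + s ^ (2 + k) * (n ^ suc k * nil-count (suc k)) ≡
           unit-count (2 + k) + s ^ (2 + k) * (n ^ suc k * unit-count (suc k)))
    nils≡ (count-step k)

  total-count′ : ∀ k →
    total (suc k) + p ^ m * unit-count (suc k) ≡ n * unit-count (suc k) + p ^ m * nil-count (suc k)
  total-count′ k = subst
    (λ s → total (suc k) + s * unit-count (suc k) ≡ n * unit-count (suc k) + s * nil-count (suc k))
    nils≡ (total-count k)

-- Solving the recurrences over ℚ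

open Data.Rational.Solver.+-*-Solver using (solve; con; _:+_; _:*_; _:-_; _:=_)

-- Moves to unnormalised fractions, where the denominator is literally 1 and no gcd has to be
-- computed.
toℚᵘ-fromℕℚ : ∀ a → toℚᵘ (fromℕℚ a) ℚᵘ.≃ ℚᵘ.mkℚᵘ (ℤ.+ a) 0
toℚᵘ-fromℕℚ a = ℚₚ.toℚᵘ-fromℚᵘ (ℚᵘ.mkℚᵘ (ℤ.+ a) 0)

fromℕℚ-+ : ∀ a b → fromℕℚ (a + b) ≡ fromℕℚ a Q.+ fromℕℚ b
fromℕℚ-+ a b = ℚₚ.toℚᵘ-injective (begin
  toℚᵘ (fromℕℚ (a + b)) ≈⟨ toℚᵘ-fromℕℚ (a + b) ⟩
  ℚᵘ.mkℚᵘ (ℤ.+ (a + b)) 0 ≈⟨ ℚᵘ.*≡*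
       (cong (ℤ._* ℤ.1ℤ) (cong₂ ℤ._+_ (sym (ℤₚ.*-identityʳ (ℤ.+ a))) (sym (ℤₚ.*-identityʳ (ℤ.+ b))))) ⟩
  ℚᵘ.mkℚᵘ (ℤ.+ a) 0 ℚᵘ.+ ℚᵘ.mkℚᵘ (ℤ.+ b) 0 ≈⟨ ℚᵘₚ.+-cong (toℚᵘ-fromℕℚ a) (toℚᵘ-fromℕℚ b) ⟨
  toℚᵘ (fromℕℚ a) ℚᵘ.+ toℚᵘ (fromℕℚ b) ≈⟨ ℚₚ.toℚᵘ-homo-+ (fromℕℚ a) (fromℕℚ b) ⟨
  toℚᵘ (fromℕℚ a Q.+ fromℕℚ b) ∎)
  where open ℚᵘₚ.≃-Reasoning

fromℕℚ-* : ∀ a b → fromℕℚ (a * b) ≡ fromℕℚ a Q.* fromℕℚ b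
fromℕℚ-* a b = ℚₚ.toℚᵘ-injective (begin
  toℚᵘ (fromℕℚ (a * b)) ≈⟨ toℚᵘ-fromℕℚ (a * b) ⟩
  ℚᵘ.mkℚᵘ (ℤ.+ (a * b)) 0 ≈⟨ ℚᵘ.*≡* (cong (ℤ._* ℤ.1ℤ) (ℤₚ.pos-* a b)) ⟩
  ℚᵘ.mkℚᵘ (ℤ.+ a) 0 ℚᵘ.* ℚᵘ.mkℚᵘ (ℤ.+ b) 0 ≈⟨ ℚᵘₚ.*-cong (toℚᵘ-fromℕℚ a) (toℚᵘ-fromℕℚ b) ⟨
  toℚᵘ (fromℕℚ a) ℚᵘ.* toℚᵘ (fromℕℚ b) ≈⟨ ℚₚ.toℚᵘ-homo-* (fromℕℚ a) (fromℕℚ b) ⟨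
  toℚᵘ (fromℕℚ a Q.* fromℕℚ b) ∎)
  where open ℚᵘₚ.≃-Reasoning

fromℕℚ-recip : ∀ a .{{_ : NonZero a}} → fromℕℚ a Q.* recipℕ a ≡ 1ℚ
fromℕℚ-recip (suc a) = ℚₚ.toℚᵘ-injective (begin
  toℚᵘ (fromℕℚ (suc a) Q.* recipℕ (suc a)) ≈⟨ ℚₚ.toℚᵘ-homo-* (fromℕℚ (suc a)) (recipℕ (suc a)) ⟩
  toℚᵘ (fromℕℚ (suc a)) ℚᵘ.* toℚᵘ (recipℕ (suc a)) ≈⟨ ℚᵘₚ.*-cong (toℚᵘ-fromℕℚ (suc a))
       (ℚₚ.toℚᵘ-fromℚᵘ (ℚᵘ.mkℚᵘ ℤ.1ℤ a)) ⟩
  ℚᵘ.mkℚᵘ (ℤ.+ suc a) 0 ℚᵘ.* ℚᵘ.mkℚᵘ ℤ.1ℤ a ≈⟨ ℚᵘ.*≡*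
       (cong ℤ.+_ (trans (ℕₚ.*-identityʳ _)
         (trans (ℕₚ.*-identityʳ (suc a)) (sym (trans (ℕₚ.*-identityˡ _) (ℕₚ.*-identityˡ (suc a))))))) ⟩
  ℚᵘ.1ℚᵘ ∎)
  where open ℚᵘₚ.≃-Reasoning

powℚ-+ : ∀ x i j → powℚ x (i + j) ≡ powℚ x i Q.* powℚ x j
powℚ-+ x zero    j = sym (ℚₚ.*-identityˡ (powℚ x j))
powℚ-+ x (suc i) j = trans (cong (x Q.*_) (powℚ-+ x i j)) (sym (ℚₚ.*-assoc x (powℚ x i) (powℚ x j)))

powℚ-distrib-* : ∀ x y i → powℚ (x Q.* y) i ≡ powℚ x i Q.* powℚ y i
powℚ-distrib-* x y zero    = sym (ℚₚ.*-identityˡ 1ℚ)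
powℚ-distrib-* x y (suc i) = trans (cong ((x Q.* y) Q.*_) (powℚ-distrib-* x y i))
  (solve 4 (λ x y a b → x :* y :* (a :* b) := x :* a :* (y :* b)) refl x y (powℚ x i) (powℚ y i))

fromℕℚ-^ : ∀ a i → fromℕℚ (a ^ i) ≡ powℚ (fromℕℚ a) i
fromℕℚ-^ a zero    = refl
fromℕℚ-^ a (suc i) = trans (fromℕℚ-* a (a ^ i)) (cong (fromℕℚ a Q.*_) (fromℕℚ-^ a i))

triangular : ℕ → ℕ
triangular r = (r * (r + 1)) / 2

-- The numerator grows by 2 (r + 1), and an even summand splits off a rounded half exactly.
triangular-suc : ∀ r → triangular (suc r) ≡ triangular r + suc r
triangular-suc r = begin
  (suc r * (suc r + 1)) / 2
    ≡⟨ cong (_/ 2) (ℕS.solve 1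
         (λ r → (ℕS.con 1 ℕS.:+ r) ℕS.:* ((ℕS.con 1 ℕS.:+ r) ℕS.:+ ℕS.con 1) ℕS.:= r ℕS.:*
           (r ℕS.:+ ℕS.con 1) ℕS.:+ (ℕS.con 1 ℕS.:+ r) ℕS.:* ℕS.con 2) refl r) ⟩
  (r * (r + 1) + suc r * 2) / 2 ≡⟨ +-distrib-/-∣ʳ (r * (r + 1)) (n∣m*n (suc r)) ⟩
  triangular r + (suc r * 2) / 2 ≡⟨ cong (triangular r +_) (m*n/n≡m (suc r) 2) ⟩
  triangular r + suc r ∎
  where
  open ≡-Reasoning
  module ℕS = +-*-Solver

module Recurrences
  (p s n : ℕ) .{{_ : NonZero p}} .{{_ : NonZero n}} (n≡ps : n ≡ p * s) (G U V : ℕ → ℕ)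
  (G₀ : G 0 ≡ 1)
  (G-step : ∀ k → G (suc k) + s ^ suc k * (n ^ k * G k) ≡ n ^ suc k * (n ^ k * G k))
  (U₁ : U 1 ≡ 1) (V₁ : V 1 ≡ 0)
  (UV-step : ∀ k → V (2 + k) + s ^ (2 + k) * (n ^ suc k * V (suc k))
                 ≡ U (2 + k) + s ^ (2 + k) * (n ^ suc k * U (suc k)))
  (GUV : ∀ k → G (suc k) + s * U (suc k) ≡ n * U (suc k) + s * V (suc k))
  where

  private
    P q N : ℚ
    P = fromℕℚ p
    q = recipℕ p
    N = fromℕℚ n

    Pq : P Q.* q ≡ 1ℚ
    Pq = fromℕℚ-recip p

    N^ q^ : ℕ → ℚ
    N^ = powℚ N
    q^ = powℚ q

    ∏ E W : ℕ → ℚ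
    ∏ r = prodℚ r (λ i → 1ℚ - q^ i)
    E r = powℚ (- 1ℚ) r Q.* q^ (triangular r)
    W r = N^ (r * r ∸ 1)

    S≡ : fromℕℚ s ≡ N Q.* q
    S≡ = begin
      fromℕℚ s ≡⟨ ℚₚ.*-identityˡ (fromℕℚ s) ⟨
      1ℚ Q.* fromℕℚ s ≡⟨ cong (Q._* fromℕℚ s) Pq ⟨
      P Q.* q Q.* fromℕℚ s
        ≡⟨ solve 3 (λ P q S → P :* q :* S := P :* S :* q) refl P q (fromℕℚ s) ⟩
      P Q.* fromℕℚ s Q.* q ≡⟨ cong (Q._* q) (trans (cong fromℕℚ n≡ps) (fromℕℚ-* p s)) ⟨
      N Q.* q ∎
      where open ≡-Reasoning

    term : ∀ j k x → fromℕℚ (s ^ j * (n ^ k * x)) ≡ N^ j Q.* q^ j Q.* (N^ k Q.* fromℕℚ x)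
    term j k x = begin
      fromℕℚ (s ^ j * (n ^ k * x))
        ≡⟨ trans (fromℕℚ-* (s ^ j) (n ^ k * x)) (cong (fromℕℚ (s ^ j) Q.*_) (fromℕℚ-* (n ^ k) x)) ⟩
      fromℕℚ (s ^ j) Q.* (fromℕℚ (n ^ k) Q.* fromℕℚ x)
        ≡⟨ cong₂ (λ a b → a Q.* (b Q.* fromℕℚ x))
             (trans (fromℕℚ-^ s j) (trans (cong (λ z → powℚ z j) S≡) (powℚ-distrib-* N q j)))
               (fromℕℚ-^ n k) ⟩
      N^ j Q.* q^ j Q.* (N^ k Q.* fromℕℚ x) ∎
      where open ≡-Reasoning

    x+y≡z⇒x≡z-y : ∀ x y {z} → x Q.+ y ≡ z → x ≡ z - y
    x+y≡z⇒x≡z-y x y refl = solve 2 (λ x y → x := x :+ y :- y) refl x y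

    G-closed : ∀ r → fromℕℚ (G r) ≡ N^ (r * r) Q.* ∏ r
    G-closed zero    = cong fromℕℚ G₀
    G-closed (suc k) = begin
      fromℕℚ (G (suc k))
        ≡⟨ x+y≡z⇒x≡z-y _ (fromℕℚ (s ^ suc k * (n ^ k * G k)))
             (trans (sym (fromℕℚ-+ (G (suc k)) (s ^ suc k * (n ^ k * G k)))) (cong fromℕℚ (G-step k))) ⟩
      fromℕℚ (n ^ suc k * (n ^ k * G k)) - fromℕℚ (s ^ suc k * (n ^ k * G k))
        ≡⟨ cong₂ _-_ (trans (fromℕℚ-* (n ^ suc k) (n ^ k * G k))
             (cong₂ Q._*_ (fromℕℚ-^ n (suc k))
               (trans (fromℕℚ-* (n ^ k) (G k)) (cong (Q._* fromℕℚ (G k)) (fromℕℚ-^ n k)))))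
                 (term (suc k) k (G k)) ⟩
      N^ (suc k) Q.* (N^ k Q.* fromℕℚ (G k)) - N^ (suc k) Q.* q^ (suc k) Q.* (N^ k Q.* fromℕℚ (G k))
        ≡⟨ cong (λ g → N^ (suc k) Q.* (N^ k Q.* g) - N^ (suc k) Q.* q^ (suc k) Q.* (N^ k Q.* g))
             (G-closed k) ⟩
      N^ (suc k) Q.* (N^ k Q.* (N^ (k * k) Q.* ∏ k)) - N^ (suc k) Q.* q^ (suc k) Q.*
          (N^ k Q.* (N^ (k * k) Q.* ∏ k))
        ≡⟨ solve 5 (λ a b c d e → a :* (b :* (c :* d)) :- a :* e :* (b :* (c :* d)) := a :*
             (b :* c) :* (d :* (con 1ℚ :- e))) refl (N^ (suc k)) (N^ k) (N^ (k * k)) (∏ k) (q^ (suc k)) ⟩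
      N^ (suc k) Q.* (N^ k Q.* N^ (k * k)) Q.* ∏ (suc k)
        ≡⟨ cong (Q._* ∏ (suc k)) (sym
             (trans (powℚ-+ N (suc k) (k * suc k))
               (cong (N^ (suc k) Q.*_) (trans (cong N^ (ℕₚ.*-suc k k)) (powℚ-+ N k (k * k)))))) ⟩
      N^ (suc k * suc k) Q.* ∏ (suc k) ∎
      where open ≡-Reasoning

    E-suc : ∀ r → E (suc r) ≡ - 1ℚ Q.* q^ (suc r) Q.* E r
    E-suc r = trans (cong (powℚ (- 1ℚ) (suc r) Q.*_)
        (trans (cong q^ (triangular-suc r)) (powℚ-+ q (triangular r) (suc r))))
      (solve 4 (λ a b c d → a :* b :* (c :* d) := a :* d :* (b :* c)) refl (- 1ℚ) (powℚ (- 1ℚ) r)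
        (q^ (triangular r)) (q^ (suc r)))

    -- The sizes are positive, so the truncated subtraction computes and the exponents are compared
    -- as polynomials in k.
    W-suc : ∀ k → W (2 + k) ≡ N^ (2 + k) Q.* N^ (suc k) Q.* W (suc k)
    W-suc k = trans (cong N^ exponent)
        (trans (powℚ-+ N (2 + k + suc k) _) (cong (Q._* W (suc k)) (powℚ-+ N (2 + k) (suc k))))
      where
      module ℕS = +-*-Solver
      exponent : suc k + suc k * (2 + k) ≡ 2 + k + suc k + (k + k * suc k)
      exponent = ℕS.solve 1 (λ k → (ℕS.con 1 ℕS.:+ k) ℕS.:+ (ℕS.con 1 ℕS.:+ k) ℕS.:*
          (ℕS.con 2 ℕS.:+ k) ℕS.:= ℕS.con 2 ℕS.:+ k ℕS.:+ (ℕS.con 1 ℕS.:+ k) ℕS.:+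
            (k ℕS.:+ k ℕS.:* (ℕS.con 1 ℕS.:+ k))) refl k

    -- As s = n/p, passing to size r multiplies the difference by -pʳ in the denominator, up to
    -- powers of n, and these exponents add up to the triangular number. The factor `P` corrects the
    -- start: the difference is -1 at size 1, whereas `E 1` is -1/p.
    V-U-closed : ∀ k → fromℕℚ (V (suc k)) - fromℕℚ (U (suc k)) ≡ W (suc k) Q.* (P Q.* E (suc k))
    V-U-closed zero = begin
      fromℕℚ (V 1) - fromℕℚ (U 1) ≡⟨ cong₂ (λ v u → fromℕℚ v - fromℕℚ u) V₁ U₁ ⟩
      - 1ℚ ≡⟨⟩
      - 1ℚ Q.* 1ℚ ≡⟨ cong (- 1ℚ Q.*_) Pq ⟨
      - 1ℚ Q.* (P Q.* q)
        ≡⟨ solve 2 (λ P q → con (- 1ℚ) :* (P :* q) := con 1ℚ :*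
             (P :* (con (- 1ℚ) :* con 1ℚ :* (q :* con 1ℚ)))) refl P q ⟩
      W 1 Q.* (P Q.* E 1) ∎
      where open ≡-Reasoning
    V-U-closed (suc k) = begin
      v′ - u′
        ≡⟨ cong (_- u′) (x+y≡z⇒x≡z-y v′ (A Q.* Q Q.* (B Q.* v))
             (trans (cong (v′ Q.+_) (sym (term (2 + k) (suc k) (V (suc k)))))
               (trans (sym (fromℕℚ-+ (V (2 + k)) (s ^ (2 + k) * (n ^ suc k * V (suc k)))))
                 (trans (cong fromℕℚ (UV-step k))
                   (trans (fromℕℚ-+ (U (2 + k)) (s ^ (2 + k) * (n ^ suc k * U (suc k))))
                     (cong (u′ Q.+_) (term (2 + k) (suc k) (U (suc k))))))))) ⟩
      u′ Q.+ A Q.* Q Q.* (B Q.* u) - A Q.* Q Q.* (B Q.* v) - u′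
        ≡⟨ solve 6 (λ u′ A Q B u v → u′ :+ A :* Q :* (B :* u) :- A :* Q :* (B :* v) :- u′ := con
             (- 1ℚ) :* (A :* Q :* B :* (v :- u))) refl u′ A Q B u v ⟩
      - 1ℚ Q.* (A Q.* Q Q.* B Q.* (v - u))
        ≡⟨ cong (λ d → - 1ℚ Q.* (A Q.* Q Q.* B Q.* d)) (V-U-closed k) ⟩
      - 1ℚ Q.* (A Q.* Q Q.* B Q.* (W (suc k) Q.* (P Q.* E (suc k))))
        ≡⟨ solve 6 (λ A Q B w P e → con (- 1ℚ) :* (A :* Q :* B :* (w :* (P :* e))) := A :* B :* w :*
             (P :* (con (- 1ℚ) :* Q :* e))) refl A Q B (W (suc k)) P (E (suc k)) ⟩
      A Q.* B Q.* W (suc k) Q.* (P Q.* (- 1ℚ Q.* Q Q.* E (suc k)))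
        ≡⟨ cong₂ (λ w e → w Q.* (P Q.* e)) (sym (W-suc k)) (sym (E-suc (suc k))) ⟩
      W (2 + k) Q.* (P Q.* E (2 + k)) ∎
      where
      open ≡-Reasoning
      u′ = fromℕℚ (U (2 + k))
      v′ = fromℕℚ (V (2 + k))
      u = fromℕℚ (U (suc k))
      v = fromℕℚ (V (suc k))
      A = N^ (2 + k)
      B = N^ (suc k)
      Q = q^ (2 + k)

  U-closed : ∀ k → fromℕℚ (U (suc k)) ≡ W (suc k) Q.* (∏ (suc k) - E (suc k))
  U-closed k = begin
    u ≡⟨ cancel u ⟨
    N⁻¹ Q.* (N Q.* u) ≡⟨ cong (N⁻¹ Q.*_) Nu ⟩
    N⁻¹ Q.* (N Q.* (w Q.* (∏ r - E r))) ≡⟨ cancel (w Q.* (∏ r - E r)) ⟩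
    w Q.* (∏ r - E r) ∎
    where
    open ≡-Reasoning
    r = suc k
    u = fromℕℚ (U r)
    v = fromℕℚ (V r)
    g = fromℕℚ (G r)
    S = fromℕℚ s
    w = W r
    N⁻¹ = recipℕ n
    cancel : ∀ x → N⁻¹ Q.* (N Q.* x) ≡ x
    cancel x = trans (solve 3 (λ a b x → a :* (b :* x) := b :* a :* x) refl N⁻¹ N x)
        (trans (cong (Q._* x) (fromℕℚ-recip n)) (ℚₚ.*-identityˡ x))
    guv : g Q.+ S Q.* u ≡ N Q.* u Q.+ S Q.* v
    guv = begin
      g Q.+ S Q.* u ≡⟨ cong (g Q.+_) (sym (fromℕℚ-* s (U r))) ⟩
      g Q.+ fromℕℚ (s * U r) ≡⟨ fromℕℚ-+ (G r) (s * U r) ⟨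
      fromℕℚ (G r + s * U r) ≡⟨ cong fromℕℚ (GUV k) ⟩
      fromℕℚ (n * U r + s * V r) ≡⟨ fromℕℚ-+ (n * U r) (s * V r) ⟩
      fromℕℚ (n * U r) Q.+ fromℕℚ (s * V r) ≡⟨ cong₂ Q._+_ (fromℕℚ-* n (U r)) (fromℕℚ-* s (V r)) ⟩
      N Q.* u Q.+ S Q.* v ∎
    Nu : N Q.* u ≡ N Q.* (w Q.* (∏ r - E r))
    Nu = begin
      N Q.* u ≡⟨ x+y≡z⇒x≡z-y (N Q.* u) (S Q.* v) (sym guv) ⟩
      g Q.+ S Q.* u - S Q.* v
        ≡⟨ solve 4 (λ g S u v → g :+ S :* u :- S :* v := g :- S :* (v :- u)) refl g S u v ⟩
      g - S Q.* (v - u)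
        -- As r is a successor, `N^ (r * r)` computes to `N Q.* w`; the 1/p in s = N/p will cancel
        -- the factor `P`.
        ≡⟨ cong₂ _-_ (G-closed r) (cong₂ Q._*_ S≡ (V-U-closed k)) ⟩
      N Q.* w Q.* ∏ r - N Q.* q Q.* (w Q.* (P Q.* E r))
        ≡⟨ solve 6 (λ N q w P pi e → N :* w :* pi :- N :* q :* (w :* (P :* e)) := N :*
             (w :* (pi :- P :* q :* e))) refl N q w P (∏ r) (E r) ⟩
      N Q.* (w Q.* (∏ r - P Q.* q Q.* E r))
        ≡⟨ cong (λ z → N Q.* (w Q.* (∏ r - z))) (trans (cong (Q._* E r) Pq) (ℚₚ.*-identityˡ (E r))) ⟩
      N Q.* (w Q.* (∏ r - E r)) ∎

  V-closed : ∀ k → fromℕℚ (V (suc k)) ≡ W (suc k) Q.* (∏ (suc k) Q.+ E (suc k) Q.* (P - 1ℚ))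
  V-closed k = begin
    v
      ≡⟨ solve 2 (λ u v → v := u :+ (v :- u)) refl u v ⟩
    u Q.+ (v - u)
      ≡⟨ cong₂ Q._+_ (U-closed k) (V-U-closed k) ⟩
    w Q.* (∏ r - E r) Q.+ w Q.* (P Q.* E r)
      ≡⟨ solve 4 (λ w pi e P → w :* (pi :- e) :+ w :* (P :* e) := w :* (pi :+ e :* (P :- con 1ℚ)))
           refl w (∏ r) (E r) P ⟩
    w Q.* (∏ r Q.+ E r Q.* (P - 1ℚ)) ∎
    where
    open ≡-Reasoning
    r = suc k
    u = fromℕℚ (U r)
    v = fromℕℚ (V r)
    w = W r

-- The closed forms for the counts over ℤ/pᵐ

^-*-fromℕℚ : ∀ p m j → fromℕℚ (p ^ (m * j)) ≡ powℚ (fromℕℚ (p ^ m)) j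
^-*-fromℕℚ p m j = trans (cong fromℕℚ (sym (ℕₚ.^-*-assoc p m j))) (fromℕℚ-^ (p ^ m) j)

theorem7 : (p m r : ℕ) → (pp : Prime p) → 1 ≤ m → 1 ≤ r →
    (β : Fin (p ^ m)) →
    ∃[ N ] (HasCard (GLWithTrace (p ^ m) r {{primePow≢0 pp m}} β) N ×
    ((gcd (toℕ β) (p ^ m) ≡ 1 →
    fromℕℚ N ≡ fromℕℚ (p ^ (m * (r * r ∸ 1)))
    Q.* (prodℚ r (λ i → 1ℚ - powℚ (recipℕ p) i)
    - powℚ (- 1ℚ) r Q.* powℚ (recipℕ p) ((r * (r + 1)) / 2)))
    × (gcd (toℕ β) (p ^ m) ≢ 1 →
    fromℕℚ N ≡ fromℕℚ (p ^ (m * (r * r ∸ 1)))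
    Q.* (prodℚ r (λ i → 1ℚ - powℚ (recipℕ p) i)
    Q.+ powℚ (- 1ℚ) r Q.* powℚ (recipℕ p) ((r * (r + 1)) / 2)
    Q.* (fromℕℚ p - 1ℚ)))))
-- The gcd is 1 exactly when β is a unit, so the two cases of the formula are the unit and the
-- nonunit traces.
theorem7 p (suc m) (suc k) pp _ _ β =
  count (suc k) β , HasCard-GLWithTrace (suc k) β ,
  (λ gcd≡1 → closed-form (proj₂ (count-class k) β (gcd≡1⇒¬Nil β gcd≡1)) (U-closed k)) ,
  (λ gcd≢1 → closed-form (proj₁ (count-class k) β (gcd≢1⇒Nil β gcd≢1)) (V-closed k))
  where
  open PrimePower p pp m
  open Recurrences p (p ^ m) n refl total unit-count nil-count
    (trSum-0 (λ _ → 1)) total-step′ unit-count-1 nil-count-1 count-step′ total-count′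

  closed-form : ∀ {c d x} → c ≡ d →
    fromℕℚ d ≡ powℚ (fromℕℚ n) (suc k * suc k ∸ 1) Q.* x →
    fromℕℚ c ≡ fromℕℚ (p ^ (suc m * (suc k * suc k ∸ 1))) Q.* x
  closed-form {x = x} refl eq = trans eq (cong (Q._* x) (sym (^-*-fromℕℚ p (suc m) (suc k * suc k ∸ 1))))
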